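{- Let $X$ be a weighted graph on $n$ vertices and let $M\in\{A(X),L(X),Q(X)\}$. If local $\epsilon$-uniform mixing occurs at a vertex $u$ of $X$ relative to $M$, then each eigenvector $\mathbf{v}=[v_1,\ldots,v_n]^T$ of $M$ satisfies $$\sqrt{n}\,|v_u|\le\sum_{j}|v_j|.$$ In particular, if $\epsilon$-uniform mixing occurs in $X$ relative to $M$, then this inequality holds for each vertex $u$ of $X$ (and each eigenvector of $M$).
   Context: Graphs are finite, simple, undirected and connected, with positive real edge weights. $A(X)$ is the weighted adjacency matrix, $D(X)$ is the diagonal matrix of vertex degrees (degree = sum of weights of incident edges), $L(X)=D(X)-A(X)$, $Q(X)=D(X)+A(X)$. Put $U(t)=e^{\mathrm{i}tM}$. $\mathbf{e}_u$ is the characteristic vector of $u$, $\mathbf{1}$ the all-ones vector, $\circ$ the entrywise product. Local $\epsilon$-uniform mixing occurs at $u$ relative to $M$ if for each $\epsilon>0$ there is a time $\tau\in\mathbb{R}$ such that $\big\|(U(\tau)\mathbf{e}_u)\circ(\overline{U(\tau)}\mathbf{e}_u)-\tfrac1n\mathbf{1}\big\|<\epsilon$. $\epsilon$-uniform mixing occurs in $X$ if for each $\epsilon>0$ there is a $\tau$ for which this inequality holds simultaneously for all vertices $u$. -}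

module Defs where

open import Algebra.Apartness.Bundles using (HeytingField; HeytingCommutativeRing)
open import Algebra.Bundles using (CommutativeRing; RawRing; Semiring)
open import Algebra.Solver.Ring.AlmostCommutativeRing using (AlmostCommutativeRing; fromCommutativeRing; _-Raw-AlmostCommutative⟶_)
open import Data.Bool.Base using (true; false; if_then_else_)
open import Data.Empty using (⊥-elim)
open import Data.Fin.Base using (Fin; zero; suc)
open import Data.Fin.Properties using (_≟_)
open import Data.Maybe.Base using (Maybe; just; nothing)
open import Data.Nat.Base as ℕ using (ℕ; zero; suc; NonZero; _!)
import Data.Nat.Properties as ℕ
open import Data.Product.Base using (∃; ∃-syntax; _×_; _,_; proj₁; proj₂)
open import Data.Sum.Base using (_⊎_; inj₁; inj₂; [_,_]′)
open import Level using (0ℓ)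
open import Relation.Binary.Construct.Closure.ReflexiveTransitive using (Star)
open import Relation.Binary.Core using (Rel)
open import Relation.Binary.Definitions using (Decidable; Symmetric; Irreflexive)
open import Relation.Binary.PropositionalEquality.Core as ≡ using (_≡_)
open import Relation.Binary.Structures using (IsStrictPartialOrder)
open import Relation.Nullary.Decidable.Core using (yes; no; does)
open import Relation.Nullary.Negation.Core using (¬_)
import Algebra.Definitions.RawSemiring
import Algebra.Properties.Ring
import Algebra.Properties.AbelianGroup
import Algebra.Properties.Semiring.Mult
import Algebra.Apartness.Properties.HeytingCommutativeRing
import Algebra.Solver.Ring
import Relation.Binary.Reasoning.Setoid

-- The real numbers, axiomatised as a complete Archimedean ordered field.  The
-- axioms are Bridges' constructive ones: the least-upper-bound principle is
-- restricted to order-located sets.  Classically every set is order-located and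
-- every nonzero element is apart from 0, so the models are then exactly the
-- complete ordered fields, i.e. ℝ up to isomorphism.  Without any classical axiom,
-- Cauchy sequences of rationals with a modulus of convergence are a model.
record RealNumbers : Set₁ where
  field
    heytingField : HeytingField 0ℓ 0ℓ 0ℓ

  open HeytingField heytingField public
  open HeytingCommutativeRing heytingCommutativeRing public using (commutativeRing)
  open CommutativeRing commutativeRing public
    using (ring; semiring; +-abelianGroup)
  open Semiring semiring public using (rawSemiring)
  open Algebra.Definitions.RawSemiring rawSemiring public
    using (sum; _^_) renaming (_×_ to _⋅_)

  infix 4 _<_ _≤_
  field
    _<_                    : Rel Carrier 0ℓ
    <-isStrictPartialOrder : IsStrictPartialOrder _≈_ _<_
    #⇒<⊎>                  : ∀ {x y} → x # y → x < y ⊎ y < x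
    <⇒#                    : ∀ {x y} → x < y → x # y
    +-monoˡ-<              : ∀ z {x y} → x < y → x + z < y + z
    *-pos                  : ∀ {x y} → 0# < x → 0# < y → 0# < x * y

  _≤_ : Rel Carrier 0ℓ
  x ≤ y = ¬ (y < x)

  UpperBound : (Carrier → Set) → Carrier → Set
  UpperBound S b = ∀ y → S y → y ≤ b

  Supremum : (Carrier → Set) → Carrier → Set
  Supremum S b = UpperBound S b × (∀ x → x < b → ∃[ y ] S y × x < y)

  OrderLocated : (Carrier → Set) → Set
  OrderLocated S = ∀ x y → x < y → (∃[ s ] S s × x < s) ⊎ UpperBound S y

  field
    archimedean : ∀ x → ∃[ n ] x < n ⋅ 1#
    supremum    : (S : Carrier → Set) → ∃ S → ∃ (UpperBound S) →
                  OrderLocated S → ∃ (Supremum S)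

-- A ring solver whose coefficients are formal differences a − b of naturals;
-- the library solvers do not cancel x − x over a ring without decidable equality.
module RingSolver (CR : CommutativeRing 0ℓ 0ℓ) where
  open CommutativeRing CR
  open Algebra.Properties.Ring ring
  open Algebra.Properties.AbelianGroup +-abelianGroup using (⁻¹-∙-comm)
  open Algebra.Properties.Semiring.Mult semiring
    using (×1-homo-*) renaming (_×_ to _⋅_; ×-homo-+ to ⋅-homo-+)
  open Relation.Binary.Reasoning.Setoid setoid

  private
    ι : ℕ → Carrier
    ι n = n ⋅ 1#

    ⟦_⟧ᶜ : ℕ × ℕ → Carrier
    ⟦ 0 , 0 ⟧ᶜ = 0#
    ⟦ 1 , 0 ⟧ᶜ = 1#
    ⟦ a , b ⟧ᶜ = ι a - ι b

    ⟦⟧ᶜ-≈ : ∀ a b → ⟦ a , b ⟧ᶜ ≈ ι a - ι b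
    ⟦⟧ᶜ-≈ 0             0       = sym (-‿inverseʳ 0#)
    ⟦⟧ᶜ-≈ 0             (suc b) = refl
    ⟦⟧ᶜ-≈ 1             0       = sym (trans (+-cong (+-identityʳ 1#) -0#≈0#) (+-identityʳ 1#))
    ⟦⟧ᶜ-≈ 1             (suc b) = refl
    ⟦⟧ᶜ-≈ (suc (suc a)) b       = refl

    normalise : ℕ → ℕ → ℕ × ℕ
    normalise (suc a) (suc b) = normalise a b
    normalise a       b       = a , b

    coeff : RawRing 0ℓ 0ℓ
    coeff = record
      { Carrier = ℕ × ℕ
      ; _≈_ = _≡_
      ; _+_ = λ { (a , b) (c , d) → normalise (a ℕ.+ c) (b ℕ.+ d) }
      ; _*_ = λ { (a , b) (c , d) → normalise (a ℕ.* c ℕ.+ b ℕ.* d) (a ℕ.* d ℕ.+ b ℕ.* c) }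
      ; -_  = λ { (a , b) → b , a }
      ; 0#  = 0 , 0
      ; 1#  = 1 , 0
      }

    interchange : ∀ x y z w → (x + y) + (z + w) ≈ (x + z) + (y + w)
    interchange x y z w = begin
      (x + y) + (z + w)  ≈⟨ +-assoc x y (z + w) ⟩
      x + (y + (z + w))  ≈⟨ +-congˡ (+-assoc y z w) ⟨
      x + ((y + z) + w)  ≈⟨ +-congˡ (+-congʳ (+-comm y z)) ⟩
      x + ((z + y) + w)  ≈⟨ +-congˡ (+-assoc z y w) ⟩
      x + (z + (y + w))  ≈⟨ +-assoc x z (y + w) ⟨
      (x + z) + (y + w)  ∎

    ι-+ : ∀ m n → ι (m ℕ.+ n) ≈ ι m + ι n
    ι-+ m n = ⋅-homo-+ 1# m n

    diff-+ : ∀ x y z w → (x + z) - (y + w) ≈ (x - y) + (z - w)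
    diff-+ x y z w = begin
      (x + z) - (y + w)      ≈⟨ +-congˡ (⁻¹-∙-comm y w) ⟨
      (x + z) + (- y + - w)  ≈⟨ interchange x z (- y) (- w) ⟩
      (x - y) + (z - w)      ∎

    normalise-≈ : ∀ a b → ⟦ normalise a b ⟧ᶜ ≈ ι a - ι b
    normalise-≈ 0       b       = ⟦⟧ᶜ-≈ 0 b
    normalise-≈ (suc a) 0       = ⟦⟧ᶜ-≈ (suc a) 0
    normalise-≈ (suc a) (suc b) = begin
      ⟦ normalise a b ⟧ᶜ       ≈⟨ normalise-≈ a b ⟩
      ι a - ι b                ≈⟨ +-identityˡ _ ⟨
      0# + (ι a - ι b)         ≈⟨ +-congʳ (-‿inverseʳ 1#) ⟨
      (1# - 1#) + (ι a - ι b)  ≈⟨ diff-+ 1# 1# (ι a) (ι b) ⟨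
      ι (suc a) - ι (suc b)    ∎

    neg-diff : ∀ x y → y - x ≈ - (x - y)
    neg-diff x y = begin
      y - x          ≈⟨ +-comm y (- x) ⟩
      - x + y        ≈⟨ +-congˡ (-‿involutive y) ⟨
      - x + - (- y)  ≈⟨ ⁻¹-∙-comm x (- y) ⟩
      - (x - y)      ∎

    diff-* : ∀ x y z w → (x * z + y * w) - (x * w + y * z) ≈ (x - y) * (z - w)
    diff-* x y z w = begin
      (x * z + y * w) - (x * w + y * z)      ≈⟨ diff-+ (x * z) (x * w) (y * w) (y * z) ⟩
      (x * z - x * w) + (y * w - y * z)      ≈⟨ +-cong (+-congˡ (-‿distribʳ-* x w)) (neg-diff (y * z) (y * w)) ⟩
      (x * z + x * - w) + - (y * z - y * w)  ≈⟨ +-cong (distribˡ x z (- w)) (-‿cong (trans (distribˡ y z (- w)) (+-congˡ (sym (-‿distribʳ-* y w))))) ⟨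
      x * (z - w) + - (y * (z - w))          ≈⟨ +-congˡ (-‿distribˡ-* y (z - w)) ⟩
      x * (z - w) + - y * (z - w)            ≈⟨ distribʳ (z - w) x (- y) ⟨
      (x - y) * (z - w)                      ∎

    almost : AlmostCommutativeRing 0ℓ 0ℓ
    almost = fromCommutativeRing CR

    morphism : coeff -Raw-AlmostCommutative⟶ almost
    morphism = record
      { ⟦_⟧    = ⟦_⟧ᶜ
      ; +-homo = λ { (a , b) (c , d) → trans (normalise-≈ (a ℕ.+ c) (b ℕ.+ d))
          (trans (+-cong (ι-+ a c) (-‿cong (ι-+ b d)))
          (trans (diff-+ (ι a) (ι b) (ι c) (ι d))
                 (sym (+-cong (⟦⟧ᶜ-≈ a b) (⟦⟧ᶜ-≈ c d))))) }
      ; *-homo = λ { (a , b) (c , d) → trans (normalise-≈ (a ℕ.* c ℕ.+ b ℕ.* d) (a ℕ.* d ℕ.+ b ℕ.* c))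
          (trans (+-cong (trans (ι-+ (a ℕ.* c) (b ℕ.* d)) (+-cong (×1-homo-* a c) (×1-homo-* b d)))
                         (-‿cong (trans (ι-+ (a ℕ.* d) (b ℕ.* c)) (+-cong (×1-homo-* a d) (×1-homo-* b c)))))
          (trans (diff-* (ι a) (ι b) (ι c) (ι d))
                 (sym (*-cong (⟦⟧ᶜ-≈ a b) (⟦⟧ᶜ-≈ c d))))) }
      ; -‿homo = λ { (a , b) → trans (⟦⟧ᶜ-≈ b a) (trans (neg-diff (ι a) (ι b)) (-‿cong (sym (⟦⟧ᶜ-≈ a b)))) }
      ; 0-homo = refl
      ; 1-homo = refl
      }

    cancel : ∀ x y z w → x + w ≈ y + z → x - y ≈ z - w
    cancel x y z w eq = begin
      x - y                  ≈⟨ +-identityʳ (x - y) ⟨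
      (x - y) + 0#           ≈⟨ +-congˡ (-‿inverseʳ w) ⟨
      (x - y) + (w - w)      ≈⟨ interchange x (- y) w (- w) ⟩
      (x + w) + (- y - w)    ≈⟨ +-congʳ eq ⟩
      (y + z) + (- y - w)    ≈⟨ interchange y z (- y) (- w) ⟩
      (y - y) + (z - w)      ≈⟨ +-congʳ (-‿inverseʳ y) ⟩
      0# + (z - w)           ≈⟨ +-identityˡ (z - w) ⟩
      z - w                  ∎

    weakDec : ∀ p q → Maybe (⟦ p ⟧ᶜ ≈ ⟦ q ⟧ᶜ)
    weakDec (a , b) (c , d) with a ℕ.+ d ℕ.≟ b ℕ.+ c
    ... | no _   = nothing
    ... | yes eq = just (trans (⟦⟧ᶜ-≈ a b) (trans
                     (cancel (ι a) (ι b) (ι c) (ι d)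
                       (trans (sym (ι-+ a d)) (trans (reflexive (≡.cong ι eq)) (ι-+ b c))))
                     (sym (⟦⟧ᶜ-≈ c d))))

  open Algebra.Solver.Ring coeff almost morphism weakDec public
    using (solve; _:=_; _:+_; _:*_; _:-_; :-_; con)

module Reals (R : RealNumbers) where
  open RealNumbers R public hiding (zero)
  open RingSolver commutativeRing
  open Algebra.Apartness.Properties.HeytingCommutativeRing heytingCommutativeRing using (1#0; x-0≈x; invertibleˡ⇒#)
  open Algebra.Properties.Semiring.Mult semiring using (×1-homo-*; ×-assoc-*; ×-congʳ)
  open IsStrictPartialOrder <-isStrictPartialOrder public
    using (<-respˡ-≈; <-respʳ-≈)
    renaming (irrefl to <-irrefl; trans to <-trans)

  <-cotrans : ∀ {x y} → x < y → ∀ z → x < z ⊎ z < y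
  <-cotrans x<y z with #-cotrans (<⇒# x<y) z
  <-cotrans x<y z | inj₁ x#z with #⇒<⊎> x#z
  ... | inj₁ x<z = inj₁ x<z
  ... | inj₂ z<x = inj₂ (<-trans z<x x<y)
  <-cotrans x<y z | inj₂ z#y with #⇒<⊎> z#y
  ... | inj₁ z<y = inj₂ z<y
  ... | inj₂ y<z = inj₁ (<-trans x<y y<z)

  <⇒≤ : ∀ {x y} → x < y → x ≤ y
  <⇒≤ x<y y<x = <-irrefl refl (<-trans x<y y<x)

  ≤-reflexive : ∀ {x y} → x ≈ y → x ≤ y
  ≤-reflexive x≈y y<x = <-irrefl (sym x≈y) y<x

  ≤-respˡ-≈ : ∀ {x y z} → x ≈ y → x ≤ z → y ≤ z
  ≤-respˡ-≈ x≈y x≤z z<y = x≤z (<-respʳ-≈ (sym x≈y) z<y)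

  ≤-respʳ-≈ : ∀ {x y z} → y ≈ z → x ≤ y → x ≤ z
  ≤-respʳ-≈ y≈z x≤y z<x = x≤y (<-respˡ-≈ (sym y≈z) z<x)

  <-≤-trans : ∀ {x y z} → x < y → y ≤ z → x < z
  <-≤-trans {z = z} x<y y≤z with <-cotrans x<y z
  ... | inj₁ x<z = x<z
  ... | inj₂ z<y = ⊥-elim (y≤z z<y)

  ≤-<-trans : ∀ {x y z} → x ≤ y → y < z → x < z
  ≤-<-trans {x = x} x≤y y<z with <-cotrans y<z x
  ... | inj₁ y<x = ⊥-elim (x≤y y<x)
  ... | inj₂ x<z = x<z

  ≤-trans : ∀ {x y z} → x ≤ y → y ≤ z → x ≤ z
  ≤-trans x≤y y≤z z<x = x≤y (≤-<-trans y≤z z<x)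

  <-by : ∀ {x y d} → 0# < d → y ≈ x + d → x < y
  <-by {x} {y} {d} 0<d y≈x+d =
    <-respˡ-≈ (+-identityˡ x) (<-respʳ-≈ (trans (+-comm d x) (sym y≈x+d)) (+-monoˡ-< x 0<d))

  ≤-by : ∀ {x y d} → 0# ≤ d → y ≈ x + d → x ≤ y
  ≤-by {x} {y} {d} 0≤d y≈x+d y<x = 0≤d
    (<-respˡ-≈ (trans (+-congʳ y≈x+d) (solve 2 (λ x d → (x :+ d) :- x := d) refl x d))
    (<-respʳ-≈ (-‿inverseʳ x) (+-monoˡ-< (- x) y<x)))

  <-diff : ∀ {x y} → x < y → 0# < y - x
  <-diff {x} x<y = <-respˡ-≈ (-‿inverseʳ x) (+-monoˡ-< (- x) x<y)

  ≤-diff : ∀ {x y} → x ≤ y → 0# ≤ y - x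
  ≤-diff {x} {y} x≤y p = x≤y
    (<-respˡ-≈ (solve 2 (λ x y → (y :- x) :+ x := y) refl x y)
    (<-respʳ-≈ (+-identityˡ x) (+-monoˡ-< x p)))

  ≤-+ : ∀ {x y} → 0# ≤ x → 0# ≤ y → 0# ≤ x + y
  ≤-+ {x} {y} 0≤x 0≤y = ≤-trans 0≤x (≤-by 0≤y refl)

  <-≤-+ : ∀ {x y} → 0# < x → 0# ≤ y → 0# < x + y
  <-≤-+ {x} {y} 0<x 0≤y = <-≤-trans 0<x (≤-by 0≤y refl)

  0≤0 : 0# ≤ 0#
  0≤0 = ≤-reflexive refl

  private
    ≈0 : ∀ {x} → 0# ≤ x → ¬ (0# < x) → x ≈ 0#
    ≈0 {x} 0≤x ≮ = proj₁ (tight x 0#) λ x#0 → case (#⇒<⊎> x#0)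
      where
      case : ¬ (x < 0# ⊎ 0# < x)
      case (inj₁ x<0) = 0≤x x<0
      case (inj₂ 0<x) = ≮ 0<x

  *-nonneg : ∀ {x y} → 0# ≤ x → 0# ≤ y → 0# ≤ x * y
  *-nonneg {x} {y} 0≤x 0≤y xy<0 = <-irrefl (trans (*-congʳ (≈0 0≤x ¬0<x)) (zeroˡ y)) xy<0
    where
    ¬0<x : ¬ (0# < x)
    ¬0<x 0<x = <-irrefl (trans (*-congˡ (≈0 0≤y λ 0<y → <⇒≤ (*-pos 0<x 0<y) xy<0)) (zeroʳ x)) xy<0

  neg-pos : ∀ {x} → x < 0# → 0# < - x
  neg-pos {x} x<0 = <-respʳ-≈ (+-identityˡ (- x)) (<-diff x<0)

  0≤x² : ∀ x → 0# ≤ x * x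
  0≤x² x x²<0 = <-irrefl (trans (*-congʳ x≈0) (zeroˡ x)) x²<0
    where
    case : ¬ (x < 0# ⊎ 0# < x)
    case (inj₁ x<0) = <⇒≤ (<-respʳ-≈ (solve 1 (λ x → :- x :* :- x := x :* x) refl x) (*-pos (neg-pos x<0) (neg-pos x<0))) x²<0
    case (inj₂ 0<x) = <⇒≤ (*-pos 0<x 0<x) x²<0
    x≈0 : x ≈ 0#
    x≈0 = proj₁ (tight x 0#) λ x#0 → case (#⇒<⊎> x#0)

  0<1 : 0# < 1#
  0<1 with #⇒<⊎> 1#0
  ... | inj₁ 1<0 = <-respʳ-≈ (solve 0 (:- con (1 , 0) :* :- con (1 , 0) := con (1 , 0)) refl) (*-pos (neg-pos 1<0) (neg-pos 1<0))
  ... | inj₂ 0<1 = 0<1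

  *-monoʳ-< : ∀ {p x y} → 0# < p → x < y → p * x < p * y
  *-monoʳ-< {p} {x} {y} 0<p x<y = <-by (*-pos 0<p (<-diff x<y)) (solve 3 (λ p x y → p :* y := p :* x :+ p :* (y :- x)) refl p x y)

  *-monoʳ-≤ : ∀ {p x y} → 0# ≤ p → x ≤ y → p * x ≤ p * y
  *-monoʳ-≤ {p} {x} {y} 0≤p x≤y = ≤-by (*-nonneg 0≤p (≤-diff x≤y)) (solve 3 (λ p x y → p :* y := p :* x :+ p :* (y :- x)) refl p x y)

  *-cancelˡ-≤ : ∀ {p x y} → 0# < p → p * x ≤ p * y → x ≤ y
  *-cancelˡ-≤ 0<p px≤py y<x = px≤py (*-monoʳ-< 0<p y<x)

  inv : ∀ {x} → x # 0# → Carrier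
  inv x#0 = proj₁ (#⇒invertible x#0)

  *-inv : ∀ {x} (x#0 : x # 0#) → x * inv x#0 ≈ 1#
  *-inv {x} x#0 = trans (*-congʳ (sym (x-0≈x x))) (proj₂ (proj₂ (#⇒invertible x#0)))

  inv-pos : ∀ {x} → 0# < x → (x#0 : x # 0#) → 0# < inv x#0
  inv-pos {x} 0<x x#0 with #⇒<⊎> (invertibleˡ⇒# {inv x#0} {0#} (x , trans (*-congˡ (x-0≈x _)) (*-inv x#0)))
  ... | inj₂ 0<y = 0<y
  ... | inj₁ y<0 = ⊥-elim (<⇒≤ 0<1 (<-by (*-pos 0<x (neg-pos y<0))
          (trans (solve 2 (λ x y → con (0 , 0) := x :* y :+ x :* :- y) refl x (inv x#0)) (+-congʳ (*-inv x#0)))))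

  *-cancelˡ-< : ∀ {p x y} → 0# < p → p * x < p * y → x < y
  *-cancelˡ-< {p} {x} {y} 0<p px<py =
    <-respˡ-≈ (undo x) (<-respʳ-≈ (undo y) (*-monoʳ-< (inv-pos 0<p p#0) px<py))
    where
    p#0 : p # 0#
    p#0 = #-sym (<⇒# 0<p)
    undo : ∀ z → inv p#0 * (p * z) ≈ z
    undo z = trans (solve 3 (λ p q z → q :* (p :* z) := (p :* q) :* z) refl p (inv p#0) z)
                   (trans (*-congʳ (*-inv p#0)) (*-identityˡ z))

  0≤fromℕ : ∀ n → 0# ≤ n ⋅ 1#
  0≤fromℕ zero    = 0≤0
  0≤fromℕ (suc n) = ≤-+ (<⇒≤ 0<1) (0≤fromℕ n)

  0<fromℕ : ∀ n → 0# < suc n ⋅ 1#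
  0<fromℕ n = <-≤-+ 0<1 (0≤fromℕ n)

  infix 9 1/_
  1/_ : (n : ℕ) .{{_ : NonZero n}} → Carrier
  1/ (suc n) = inv (#-sym (<⇒# (0<fromℕ n)))

  *-1/ : ∀ n .{{_ : NonZero n}} → n ⋅ 1# * 1/ n ≈ 1#
  *-1/ (suc n) = *-inv (#-sym (<⇒# (0<fromℕ n)))

  0<1/ : ∀ n .{{_ : NonZero n}} → 0# < 1/ n
  0<1/ (suc n) = inv-pos (0<fromℕ n) _

  trisect : ∀ {x y} → x < y → ∃[ d ] 0# < d × y ≈ x + (d + (d + d))
  trisect {x} {y} x<y = (y - x) * 1/ 3 , *-pos (<-diff x<y) (0<1/ 3) , sym (trans
    (solve 3 (λ x y t → x :+ ((y :- x) :* t :+ ((y :- x) :* t :+ (y :- x) :* t))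
                      := x :+ (y :- x) :* ((con (1 , 0) :+ (con (1 , 0) :+ (con (1 , 0) :+ con (0 , 0)))) :* t)) refl x y (1/ 3))
    (trans (+-congˡ (*-congˡ (*-1/ 3)))
           (solve 2 (λ x y → x :+ (y :- x) :* con (1 , 0) := y) refl x y)))

  between : ∀ {x y} → x < y → ∃[ z ] x < z × z < y
  between {x} x<y = let (d , 0<d , y≈) = trisect x<y in
    x + d , <-by 0<d refl , <-by (<-≤-+ 0<d (<⇒≤ 0<d)) (trans y≈ (sym (+-assoc x d (d + d))))

  -- √ x is the least upper bound of { y | y ≤ 0 or y² ≤ x }; in particular √ x is
  -- 0 for negative x.
  module SquareRoot (x : Carrier) where
    Below : Carrier → Set
    Below y = 0# < y → y * y ≤ x

    below-0 : Below 0#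
    below-0 0<0 = ⊥-elim (<-irrefl refl 0<0)

    x≤x²+1 : x ≤ x * x + 1#
    x≤x²+1 = *-cancelˡ-≤ (<-≤-+ 0<1 (<⇒≤ 0<1))
      (≤-by (≤-+ (0≤x² (x - 1#)) (≤-+ (0≤x² x) (<⇒≤ 0<1)))
      (solve 1 (λ x → let one = con (1 , 0) in
         (one :+ one) :* (x :* x :+ one) := (one :+ one) :* x :+ ((x :- one) :* (x :- one) :+ (x :* x :+ one))) refl x))

    bounded : UpperBound Below (x * x + 1#)
    bounded y y∈S b<y = y∈S (<-trans 0<1 1<y) (≤-<-trans x≤x²+1 (<-trans b<y y<y²))
      where
      1<y : 1# < y
      1<y = ≤-<-trans (≤-by (0≤x² x) (+-comm (x * x) 1#)) b<y
      y<y² : y < y * y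
      y<y² = <-by (*-pos (<-trans 0<1 1<y) (<-diff 1<y)) (solve 1 (λ y → y :* y := y :+ y :* (y :- con (1 , 0))) refl y)

    square-< : ∀ {y z} → 0# < y → y < z → y * y < z * z
    square-< {y} {z} 0<y y<z = <-trans (*-monoʳ-< 0<y y<z) (<-respˡ-≈ (*-comm z y) (*-monoʳ-< (<-trans 0<y y<z) y<z))

    located : OrderLocated Below
    located a b a<b = [ (λ a<0 → inj₁ (0# , below-0 , a<0))
                      , (λ 0<c → [ (λ c²<x → inj₁ (c , (λ _ → <⇒≤ c²<x) , a<c))
                                 , (λ x<b² → inj₂ λ y y∈S b<y →
                                     y∈S (<-trans (<-trans 0<c c<b) b<y) (<-trans x<b² (square-< (<-trans 0<c c<b) b<y)))
                                 ]′ (<-cotrans (square-< 0<c c<b) x))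
                      ]′ (<-cotrans a<c 0#)
      where
      c : Carrier
      c = proj₁ (between a<b)
      a<c : a < c
      a<c = proj₁ (proj₂ (between a<b))
      c<b : c < b
      c<b = proj₂ (proj₂ (between a<b))

  opaque
    √ : Carrier → Carrier
    √ x = proj₁ (supremum Below (0# , below-0) (x * x + 1# , bounded) located)
      where open SquareRoot x

    √-supremum : ∀ x → Supremum (SquareRoot.Below x) (√ x)
    √-supremum x = proj₂ (supremum Below (0# , below-0) (x * x + 1# , bounded) located)
      where open SquareRoot x

  Cauchy : (ℕ → Carrier) → Set
  Cauchy a = ∀ ε → 0# < ε → ∃[ N ] (∀ m n → N ℕ.≤ m → N ℕ.≤ n → a m < a n + ε)

  _⟶_ : (ℕ → Carrier) → Carrier → Set
  a ⟶ l = ∀ ε → 0# < ε → ∃[ N ] (∀ n → N ℕ.≤ n → a n < l + ε × l < a n + ε)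

  module Limit (a : ℕ → Carrier) (cauchy : Cauchy a) where
    Eventually≤ : Carrier → Set
    Eventually≤ y = ∃[ N ] (∀ n → N ℕ.≤ n → y ≤ a n)

    below : ∀ {ε N} → (∀ m n → N ℕ.≤ m → N ℕ.≤ n → a m < a n + ε) →
            ∀ m → N ℕ.≤ m → Eventually≤ (a m - ε)
    below {ε} {N} near m N≤m = N , λ n N≤n → ≤-by (<⇒≤ (<-diff (near m n N≤m N≤n)))
      (solve 3 (λ am an ε → an := (am :- ε) :+ ((an :+ ε) :- am)) refl (a m) (a n) ε)

    above : ∀ {ε N} → (∀ m n → N ℕ.≤ m → N ℕ.≤ n → a m < a n + ε) →
            ∀ n → N ℕ.≤ n → UpperBound Eventually≤ (a n + ε)
    above {ε} {N} near n N≤n y (K , y≤) = ≤-trans (y≤ (N ℕ.⊔ K) (ℕ.m≤n⊔m N K))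
      (<⇒≤ (near (N ℕ.⊔ K) n (ℕ.m≤m⊔n N K) N≤n))

    located : OrderLocated Eventually≤
    located x y x<y =
      [ (λ x+d<a → inj₁ (a N - d , below near N ℕ.≤-refl , <-by (<-diff x+d<a)
          (solve 3 (λ x d a → a :- d := x :+ (a :- (x :+ d))) refl x d (a N))))
      , (λ a<x+2d → inj₂ λ s s∈S → ≤-trans (above near N ℕ.≤-refl s s∈S)
          (≤-by (<⇒≤ (<-diff a<x+2d)) (trans y≈
            (solve 3 (λ x d a → x :+ (d :+ (d :+ d)) := (a :+ d) :+ ((x :+ (d :+ d)) :- a)) refl x d (a N)))))
      ]′ (<-cotrans {x + d} {x + (d + d)} (<-by 0<d (sym (+-assoc x d d))) (a N))
      where
      d : Carrier
      d = proj₁ (trisect x<y)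
      0<d : 0# < d
      0<d = proj₁ (proj₂ (trisect x<y))
      y≈ : y ≈ x + (d + (d + d))
      y≈ = proj₂ (proj₂ (trisect x<y))
      N : ℕ
      N = proj₁ (cauchy d 0<d)
      near : ∀ m n → N ℕ.≤ m → N ℕ.≤ n → a m < a n + d
      near = proj₂ (cauchy d 0<d)

    limit : ∃ (Supremum Eventually≤)
    limit = supremum Eventually≤ (_ , below near N ℕ.≤-refl) (_ , above near N ℕ.≤-refl) located
      where
      N : ℕ
      N = proj₁ (cauchy 1# 0<1)
      near : ∀ m n → N ℕ.≤ m → N ℕ.≤ n → a m < a n + 1#
      near = proj₂ (cauchy 1# 0<1)

    converges : a ⟶ proj₁ limit
    converges ε 0<ε = N , λ n N≤n →
        ≤-<-trans (≤-by (≤-diff (proj₁ (proj₂ limit) _ (below near n N≤n)))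
          (solve 3 (λ l d an → l :+ d := an :+ (l :- (an :- d))) refl (proj₁ limit) d (a n)))
          (+-monoʳ-< (proj₁ limit) d<ε)
      , ≤-<-trans (λ p → let (s , s∈S , q) = proj₂ (proj₂ limit) _ p in above near n N≤n s s∈S q)
          (+-monoʳ-< (a n) d<ε)
      where
      d : Carrier
      d = proj₁ (between 0<ε)
      0<d : 0# < d
      0<d = proj₁ (proj₂ (between 0<ε))
      d<ε : d < ε
      d<ε = proj₂ (proj₂ (between 0<ε))
      N : ℕ
      N = proj₁ (cauchy d 0<d)
      near : ∀ m n → N ℕ.≤ m → N ℕ.≤ n → a m < a n + d
      near = proj₂ (cauchy d 0<d)
      +-monoʳ-< : ∀ z {x y} → x < y → z + x < z + y
      +-monoʳ-< z {x} {y} x<y = <-by (<-diff x<y) (solve 3 (λ x y z → z :+ y := (z :+ x) :+ (y :- x)) refl x y z)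

  opaque
    lim : (a : ℕ → Carrier) → Cauchy a → ∃[ l ] a ⟶ l
    lim a cauchy = proj₁ limit , converges
      where open Limit a cauchy

  1/!_ : ℕ → Carrier
  1/! k = 1/_ (k !) {{k ℕ.!≢0}}

  partialSum : (ℕ → Carrier) → ℕ → Carrier
  partialSum a zero    = 0#
  partialSum a (suc N) = partialSum a N + a N

  infix 4 ∣_∣≤_
  ∣_∣≤_ : Carrier → Carrier → Set
  ∣ x ∣≤ b = 0# ≤ b - x × 0# ≤ b + x

  module ExponentialSeries (c : Carrier) (0≤c : 0# ≤ c) where
    bound : ℕ → Carrier
    bound k = c ^ k * 1/! k

    0≤c^ : ∀ k → 0# ≤ c ^ k
    0≤c^ zero    = <⇒≤ 0<1
    0≤c^ (suc k) = *-nonneg 0≤c (0≤c^ k)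

    0≤bound : ∀ k → 0# ≤ bound k
    0≤bound k = *-nonneg (0≤c^ k) (<⇒≤ (0<1/ (k !) {{k ℕ.!≢0}}))

    1/!-suc : ∀ k → (suc k ⋅ 1#) * 1/! (suc k) ≈ 1/! k
    1/!-suc k = trans (sym (*-identityʳ _)) (trans (*-congˡ (sym (*-1/ (k !) {{k ℕ.!≢0}})))
      (trans (solve 4 (λ s r f r′ → (s :* r) :* (f :* r′) := ((s :* f) :* r) :* r′) refl (suc k ⋅ 1#) (1/! (suc k)) ((k !) ⋅ 1#) (1/! k))
      (trans (*-congʳ (*-congʳ (sym (×1-homo-* (suc k) (k !)))))
      (trans (*-congʳ (*-1/ (suc k !) {{suc k ℕ.!≢0}})) (*-identityˡ _)))))

    bound-suc : ∀ k → (suc k ⋅ 1#) * bound (suc k) ≈ c * bound k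
    bound-suc k = trans (solve 4 (λ s c p r → s :* ((c :* p) :* r) := (c :* p) :* (s :* r)) refl (suc k ⋅ 1#) c (c ^ k) (1/! (suc k)))
      (trans (*-congˡ (1/!-suc k)) (*-assoc c (c ^ k) (1/! k)))

    private
      m : ℕ
      m = proj₁ (archimedean (c + c))

    fromℕ-mono : ∀ j n → n ⋅ 1# ≤ (j ℕ.+ n) ⋅ 1#
    fromℕ-mono zero    n = ≤-reflexive refl
    fromℕ-mono (suc j) n = ≤-trans (fromℕ-mono j n) (≤-by (<⇒≤ 0<1) (+-comm 1# _))

    halving : ∀ j → let k = j ℕ.+ m in bound (suc k) + bound (suc k) ≤ bound k
    halving j = *-cancelˡ-≤ (0<fromℕ k) (≤-by
      (*-nonneg (≤-diff (≤-trans (<⇒≤ (proj₂ (archimedean (c + c)))) (fromℕ-mono (suc j) m))) (0≤bound k))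
      (trans (solve 3 (λ s c b → s :* b := (c :* b :+ c :* b) :+ (s :- (c :+ c)) :* b) refl (suc k ⋅ 1#) c (bound k))
        (+-congʳ (sym (trans (distribˡ (suc k ⋅ 1#) (bound (suc k)) (bound (suc k))) (+-cong (bound-suc k) (bound-suc k)))))))
      where
      k : ℕ
      k = j ℕ.+ m

    decay : ∀ j → (suc j ⋅ 1#) * bound (j ℕ.+ m) ≤ bound m
    decay zero    = ≤-reflexive (trans (*-congʳ (+-identityʳ 1#)) (*-identityˡ _))
    decay (suc j) = ≤-trans (≤-by
      (≤-+ (*-nonneg (0≤fromℕ j) (0≤bound (suc k))) (*-nonneg (0≤fromℕ (suc j)) (≤-diff (halving j))))
      (solve 3 (λ s b b′ → let one = con (1 , 0) in
        (one :+ s) :* b := (one :+ (one :+ s)) :* b′ :+ (s :* b′ :+ (one :+ s) :* (b :- (b′ :+ b′))))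
        refl (j ⋅ 1#) (bound k) (bound (suc k)))) (decay j)
      where
      k : ℕ
      k = j ℕ.+ m

    module Dominated (a : ℕ → Carrier) (a≤ : ∀ k → ∣ a k ∣≤ bound k) where
      private
        upper lower : ℕ → Carrier
        upper k = partialSum a k + (bound k + bound k)
        lower k = partialSum a k - (bound k + bound k)

        upper-suc : ∀ j → upper (suc j ℕ.+ m) ≤ upper (j ℕ.+ m)
        upper-suc j = ≤-by
          (≤-+ (proj₁ (a≤ k)) (≤-diff (halving j)))
          (solve 4 (λ A a b b′ → A :+ (b :+ b)
              := ((A :+ a) :+ (b′ :+ b′)) :+ ((b :- a) :+ (b :- (b′ :+ b′))))
            refl (partialSum a k) (a k) (bound k) (bound (suc k)))
          where
          k : ℕ
          k = j ℕ.+ m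

        lower-suc : ∀ j → lower (j ℕ.+ m) ≤ lower (suc j ℕ.+ m)
        lower-suc j = ≤-by
          (≤-+ (proj₂ (a≤ k)) (≤-diff (halving j)))
          (solve 4 (λ A a b b′ → (A :+ a) :- (b′ :+ b′)
              := (A :- (b :+ b)) :+ ((b :+ a) :+ (b :- (b′ :+ b′))))
            refl (partialSum a k) (a k) (bound k) (bound (suc k)))
          where
          k : ℕ
          k = j ℕ.+ m

        upper-≤ : ∀ i j → upper (i ℕ.+ (j ℕ.+ m)) ≤ upper (j ℕ.+ m)
        upper-≤ zero    j = ≤-reflexive refl
        upper-≤ (suc i) j = ≤-trans
          (≡.subst (λ t → upper (suc t) ≤ upper t) (ℕ.+-assoc i j m) (upper-suc (i ℕ.+ j)))
          (upper-≤ i j)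

        lower-≤ : ∀ i j → lower (j ℕ.+ m) ≤ lower (i ℕ.+ (j ℕ.+ m))
        lower-≤ zero    j = ≤-reflexive refl
        lower-≤ (suc i) j = ≤-trans (lower-≤ i j)
          (≡.subst (λ t → lower t ≤ lower (suc t)) (ℕ.+-assoc i j m) (lower-suc (i ℕ.+ j)))

        sum≤upper : ∀ j n → j ℕ.+ m ℕ.≤ n → partialSum a n ≤ upper (j ℕ.+ m)
        sum≤upper j n N≤n = ≤-trans (≤-by (≤-+ (0≤bound n) (0≤bound n)) refl)
          (≡.subst (λ t → upper t ≤ upper (j ℕ.+ m)) (ℕ.m∸n+n≡m N≤n) (upper-≤ (n ℕ.∸ (j ℕ.+ m)) j))

        lower≤sum : ∀ j n → j ℕ.+ m ℕ.≤ n → lower (j ℕ.+ m) ≤ partialSum a n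
        lower≤sum j n N≤n = ≤-trans
          (≡.subst (λ t → lower (j ℕ.+ m) ≤ lower t) (ℕ.m∸n+n≡m N≤n) (lower-≤ (n ℕ.∸ (j ℕ.+ m)) j))
          (≤-by (≤-+ (0≤bound n) (0≤bound n))
            (solve 2 (λ A b → A := (A :- (b :+ b)) :+ (b :+ b)) refl (partialSum a n) (bound n)))

        four : Carrier → Carrier
        four x = (x + x) + (x + x)

      cauchy : Cauchy (partialSum a)
      cauchy ε 0<ε = j ℕ.+ m , λ p q N≤p N≤q → ≤-<-trans
          (≤-by (≤-+ (≤-diff (sum≤upper j p N≤p)) (≤-diff (lower≤sum j q N≤q)))
            (solve 4 (λ A P Q b → Q :+ ((b :+ b) :+ (b :+ b))
                := P :+ (((A :+ (b :+ b)) :- P) :+ (Q :- (A :- (b :+ b)))))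
              refl (partialSum a (j ℕ.+ m)) (partialSum a p) (partialSum a q) (bound (j ℕ.+ m))))
          (<-by (<-diff small) (solve 3 (λ Q f ε → Q :+ ε := (Q :+ f) :+ (ε :- f)) refl (partialSum a q) (four (bound (j ℕ.+ m))) ε))
        where
        ε#0 : ε # 0#
        ε#0 = #-sym (<⇒# 0<ε)
        j : ℕ
        j = proj₁ (archimedean (four (bound m) * inv ε#0))
        4b<jε : four (bound m) < (j ⋅ 1#) * ε
        4b<jε = <-respˡ-≈
          (trans (solve 3 (λ e f i → e :* (f :* i) := f :* (e :* i)) refl ε (four (bound m)) (inv ε#0))
                 (trans (*-congˡ (*-inv ε#0)) (*-identityʳ _)))
          (<-respʳ-≈ (*-comm ε (j ⋅ 1#)) (*-monoʳ-< 0<ε (proj₂ (archimedean (four (bound m) * inv ε#0)))))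
        small : four (bound (j ℕ.+ m)) < ε
        small = *-cancelˡ-< (0<fromℕ j) (≤-<-trans
          (≤-by (≤-+ (≤-+ d d) (≤-+ d d))
            (solve 3 (λ s b b′ → (b :+ b) :+ (b :+ b)
                := s :* ((b′ :+ b′) :+ (b′ :+ b′)) :+ (((b :- s :* b′) :+ (b :- s :* b′)) :+ ((b :- s :* b′) :+ (b :- s :* b′))))
              refl (suc j ⋅ 1#) (bound m) (bound (j ℕ.+ m))))
          (<-trans 4b<jε (<-by 0<ε
            (solve 2 (λ s e → (con (1 , 0) :+ s) :* e := s :* e :+ e) refl (j ⋅ 1#) ε))))
          where
          d : 0# ≤ bound m - (suc j ⋅ 1#) * bound (j ℕ.+ m)
          d = ≤-diff (decay j)

  ∣∣≤-+ : ∀ {x y b d} → ∣ x ∣≤ b → ∣ y ∣≤ d → ∣ x + y ∣≤ b + d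
  ∣∣≤-+ {x} {y} {b} {d} (p , q) (p′ , q′) =
      ≤-respʳ-≈ (solve 4 (λ x y b d → (b :- x) :+ (d :- y) := (b :+ d) :- (x :+ y)) refl x y b d) (≤-+ p p′)
    , ≤-respʳ-≈ (solve 4 (λ x y b d → (b :+ x) :+ (d :+ y) := (b :+ d) :+ (x :+ y)) refl x y b d) (≤-+ q q′)

  ∣∣≤-neg : ∀ {x b} → ∣ x ∣≤ b → ∣ - x ∣≤ b
  ∣∣≤-neg {x} {b} (p , q) = ≤-respʳ-≈ (solve 2 (λ x b → b :+ x := b :- (:- x)) refl x b) q , p

  ∣∣≤-* : ∀ {x y b d} → ∣ x ∣≤ b → ∣ y ∣≤ d → ∣ x * y ∣≤ b * d
  ∣∣≤-* {x} {y} {b} {d} (p , q) (p′ , q′) =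
      half (≤-respʳ-≈ (solve 4 (λ x y b d → (b :- x) :* (d :+ y) :+ (b :+ x) :* (d :- y)
          := (b :* d :- x :* y) :+ (b :* d :- x :* y)) refl x y b d) (≤-+ (*-nonneg p q′) (*-nonneg q p′)))
    , half (≤-respʳ-≈ (solve 4 (λ x y b d → (b :- x) :* (d :- y) :+ (b :+ x) :* (d :+ y)
          := (b :* d :+ x :* y) :+ (b :* d :+ x :* y)) refl x y b d) (≤-+ (*-nonneg p p′) (*-nonneg q q′)))
    where
    half : ∀ {z} → 0# ≤ z + z → 0# ≤ z
    half 0≤z+z z<0 = 0≤z+z (<-trans (<-respʳ-≈ (+-identityˡ _) (+-monoˡ-< _ z<0)) z<0)

  ∣∣≤-resp : ∀ {x b d} → b ≈ d → ∣ x ∣≤ b → ∣ x ∣≤ d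
  ∣∣≤-resp b≈d (p , q) = ≤-respʳ-≈ (+-congʳ b≈d) p , ≤-respʳ-≈ (+-congʳ b≈d) q

  ∣∣≤-mono : ∀ {x b d} → b ≤ d → ∣ x ∣≤ b → ∣ x ∣≤ d
  ∣∣≤-mono {x} {b} {d} b≤d (p , q) =
      ≤-respʳ-≈ (solve 3 (λ x b d → (b :- x) :+ (d :- b) := d :- x) refl x b d) (≤-+ p (≤-diff b≤d))
    , ≤-respʳ-≈ (solve 3 (λ x b d → (b :+ x) :+ (d :- b) := d :+ x) refl x b d) (≤-+ q (≤-diff b≤d))

  ∣∣≤-sum : ∀ {n b} (f : Fin n → Carrier) → (∀ i → ∣ f i ∣≤ b) → ∣ sum f ∣≤ n ⋅ b
  ∣∣≤-sum {zero}  f f≤ = ≤-reflexive (sym (-‿inverseʳ 0#)) , ≤-reflexive (sym (+-identityˡ 0#))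
  ∣∣≤-sum {suc n} f f≤ = ∣∣≤-+ (f≤ zero) (∣∣≤-sum (λ i → f (suc i)) (λ i → f≤ (suc i)))

  x≤sum : ∀ {n} (f : Fin n → Carrier) → (∀ i → 0# ≤ f i) → ∀ i → f i ≤ sum f
  0≤sum : ∀ {n} (f : Fin n → Carrier) → (∀ i → 0# ≤ f i) → 0# ≤ sum f
  x≤sum f 0≤f zero    = ≤-by (0≤sum (λ i → f (suc i)) (λ i → 0≤f (suc i))) refl
  x≤sum f 0≤f (suc i) = ≤-trans (x≤sum (λ i → f (suc i)) (λ i → 0≤f (suc i)) i) (≤-by (0≤f zero) (+-comm _ _))
  0≤sum {zero}  f 0≤f = 0≤0
  0≤sum {suc n} f 0≤f = ≤-+ (0≤f zero) (0≤sum (λ i → f (suc i)) (λ i → 0≤f (suc i)))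

  ∣x∣≤x²+1 : ∀ x → ∣ x ∣≤ x * x + 1#
  ∣x∣≤x²+1 x = go x , ≤-respʳ-≈ (solve 1 (λ x → (:- x :* :- x :+ con (1 , 0)) :- :- x := (x :* x :+ con (1 , 0)) :+ x) refl x) (go (- x))
    where
    go : ∀ x → 0# ≤ (x * x + 1#) - x
    go x = ≤-diff (SquareRoot.x≤x²+1 x)

  infix 6 _+i_
  record ℂ : Set where
    constructor _+i_
    field
      re im : Carrier
  open ℂ public

  infix  4 _≈ᶜ_
  infixl 6 _+ᶜ_ _-ᶜ_
  infixl 7 _*ᶜ_

  _≈ᶜ_ : ℂ → ℂ → Set
  z ≈ᶜ w = re z ≈ re w × im z ≈ im w

  ofReal : Carrier → ℂ
  ofReal x = x +i 0#

  0ᶜ 1ᶜ 𝕚 : ℂ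
  0ᶜ = ofReal 0#
  1ᶜ = ofReal 1#
  𝕚  = 0# +i 1#

  _+ᶜ_ _-ᶜ_ _*ᶜ_ : ℂ → ℂ → ℂ
  z +ᶜ w = (re z + re w) +i (im z + im w)
  z -ᶜ w = (re z - re w) +i (im z - im w)
  z *ᶜ w = (re z * re w - im z * im w) +i (re z * im w + im z * re w)

  conj : ℂ → ℂ
  conj z = re z +i (- im z)

  normSq : ℂ → Carrier
  normSq z = re z * re z + im z * im z

  ∣_∣ : ℂ → Carrier
  ∣ z ∣ = √ (normSq z)

  sumᶜ : ∀ {n} → (Fin n → ℂ) → ℂ
  sumᶜ z = sum (λ j → re (z j)) +i sum (λ j → im (z j))

  Vectorᶜ Matrixʳ Matrixᶜ : ℕ → Set
  Vectorᶜ n = Fin n → ℂ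
  Matrixʳ n = Fin n → Fin n → Carrier
  Matrixᶜ n = Fin n → Fin n → ℂ

  complexify : ∀ {n} → Matrixʳ n → Matrixᶜ n
  complexify M i j = ofReal (M i j)

  _*ᵥ_ : ∀ {n} → Matrixᶜ n → Vectorᶜ n → Vectorᶜ n
  (Z *ᵥ v) i = sumᶜ λ j → Z i j *ᶜ v j

  _*ₘ_ : ∀ {n} → Matrixᶜ n → Matrixᶜ n → Matrixᶜ n
  (Z *ₘ W) i j = sumᶜ λ l → Z i l *ᶜ W l j

  _∙ₘ_ : ∀ {n} → ℂ → Matrixᶜ n → Matrixᶜ n
  (z ∙ₘ Z) i j = z *ᶜ Z i j

  conjₘ : ∀ {n} → Matrixᶜ n → Matrixᶜ n
  conjₘ Z i j = conj (Z i j)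

  𝕖 : ∀ {n} → Fin n → Vectorᶜ n
  𝕖 u j = if does (u ≟ j) then 1ᶜ else 0ᶜ

  idₘ : ∀ {n} → Matrixᶜ n
  idₘ = 𝕖

  _^ₘ_ : ∀ {n} → Matrixᶜ n → ℕ → Matrixᶜ n
  Z ^ₘ zero  = idₘ
  Z ^ₘ suc k = Z *ₘ (Z ^ₘ k)

  ‖_‖ : ∀ {n} → Vectorᶜ n → Carrier
  ‖ v ‖ = √ (sum λ j → normSq (v j))

  module MatrixExponential {n} (Z : Matrixᶜ n) where
    reTerm imTerm : Fin n → Fin n → ℕ → Carrier
    reTerm i j k = 1/! k * re ((Z ^ₘ k) i j)
    imTerm i j k = 1/! k * im ((Z ^ₘ k) i j)

    private
      size : Fin n → Fin n → Carrier
      size i j = (re (Z i j) * re (Z i j) + 1#) + (im (Z i j) * im (Z i j) + 1#)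

      0≤x²+1 : ∀ x → 0# ≤ x * x + 1#
      0≤x²+1 x = ≤-+ (0≤x² x) (<⇒≤ 0<1)

      0≤size : ∀ i j → 0# ≤ size i j
      0≤size i j = ≤-+ (0≤x²+1 _) (0≤x²+1 _)

      B c : Carrier
      B = sum λ i → sum (size i)
      c = n ⋅ (B + B)

      size≤B : ∀ i j → size i j ≤ B
      size≤B i j = ≤-trans (x≤sum (size i) (0≤size i) j) (x≤sum (λ i → sum (size i)) (λ i → 0≤sum (size i) (0≤size i)) i)

      0≤B : 0# ≤ B
      0≤B = 0≤sum _ λ i → 0≤sum (size i) (0≤size i)

      0≤⋅ : ∀ n {x} → 0# ≤ x → 0# ≤ n ⋅ x
      0≤⋅ zero    0≤x = 0≤0
      0≤⋅ (suc n) 0≤x = ≤-+ 0≤x (0≤⋅ n 0≤x)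

      0≤c : 0# ≤ c
      0≤c = 0≤⋅ n (≤-+ 0≤B 0≤B)

      Bounded : Carrier → ℂ → Set
      Bounded b z = ∣ re z ∣≤ b × ∣ im z ∣≤ b

      Z≤B : ∀ i j → Bounded B (Z i j)
      Z≤B i j = ∣∣≤-mono (≤-trans (≤-by (0≤x²+1 _) refl) (size≤B i j)) (∣x∣≤x²+1 _)
              , ∣∣≤-mono (≤-trans (≤-by (0≤x²+1 _) (+-comm _ _)) (size≤B i j)) (∣x∣≤x²+1 _)

      bounded-* : ∀ {b d z w} → Bounded b z → Bounded d w → Bounded (b * d + b * d) (z *ᶜ w)
      bounded-* (p , q) (p′ , q′) = ∣∣≤-+ (∣∣≤-* p p′) (∣∣≤-neg (∣∣≤-* q q′)) , ∣∣≤-+ (∣∣≤-* p q′) (∣∣≤-* q p′)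

      ∣0∣≤1 : ∣ 0# ∣≤ 1#
      ∣0∣≤1 = ≤-respʳ-≈ (solve 0 (con (1 , 0) := con (1 , 0) :- con (0 , 0)) refl) (<⇒≤ 0<1) , ≤-+ (<⇒≤ 0<1) 0≤0

      ∣1∣≤1 : ∣ 1# ∣≤ 1#
      ∣1∣≤1 = ≤-reflexive (sym (-‿inverseʳ 1#)) , ≤-+ (<⇒≤ 0<1) (<⇒≤ 0<1)

      open ExponentialSeries c 0≤c

      pow≤ : ∀ k i j → Bounded (c ^ k) ((Z ^ₘ k) i j)
      pow≤ zero i j with does (i ≟ j)
      ... | true  = ∣1∣≤1 , ∣0∣≤1
      ... | false = ∣0∣≤1 , ∣0∣≤1
      pow≤ (suc k) i j = ∣∣≤-resp eq (∣∣≤-sum _ λ l → proj₁ (entry l)) , ∣∣≤-resp eq (∣∣≤-sum _ λ l → proj₂ (entry l))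
        where
        entry : ∀ l → Bounded (B * c ^ k + B * c ^ k) (Z i l *ᶜ (Z ^ₘ k) l j)
        entry l = bounded-* (Z≤B i l) (pow≤ k l j)
        eq : n ⋅ (B * c ^ k + B * c ^ k) ≈ c * c ^ k
        eq = trans (×-congʳ n (sym (distribʳ (c ^ k) B B))) (sym (×-assoc-* n (B + B) (c ^ k)))

      term≤ : ∀ k {x} → ∣ x ∣≤ c ^ k → ∣ 1/! k * x ∣≤ bound k
      term≤ k x≤ = ∣∣≤-resp (*-comm _ _) (∣∣≤-* (≤-reflexive (sym (-‿inverseʳ _)) , ≤-+ 0≤1/! 0≤1/!) x≤)
        where
        0≤1/! : 0# ≤ 1/! k
        0≤1/! = <⇒≤ (0<1/ (k !) {{k ℕ.!≢0}})

    opaque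
      reCauchy : ∀ i j → Cauchy (partialSum (reTerm i j))
      reCauchy i j = Dominated.cauchy (reTerm i j) λ k → term≤ k (proj₁ (pow≤ k i j))

      imCauchy : ∀ i j → Cauchy (partialSum (imTerm i j))
      imCauchy i j = Dominated.cauchy (imTerm i j) λ k → term≤ k (proj₂ (pow≤ k i j))

  -- the entrywise limit of the partial sums of Σₖ Zᵏ / k!
  expₘ : ∀ {n} → Matrixᶜ n → Matrixᶜ n
  expₘ Z i j = proj₁ (lim (partialSum (reTerm i j)) (reCauchy i j))
            +i proj₁ (lim (partialSum (imTerm i j)) (imCauchy i j))
    where open MatrixExponential Z

  record WeightedGraph (n : ℕ) : Set₁ where
    field
      Edge        : Rel (Fin n) 0ℓ
      edge?       : Decidable Edge
      edge-sym    : Symmetric Edge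
      edge-irrefl : Irreflexive _≡_ Edge
      connected   : ∀ i j → Star Edge i j
      weight      : Fin n → Fin n → Carrier
      weight-sym  : ∀ i j → weight i j ≈ weight j i
      weight-pos  : ∀ {i j} → Edge i j → 0# < weight i j
      weight-zero : ∀ {i j} → ¬ Edge i j → weight i j ≈ 0#

  module _ {n} (X : WeightedGraph n) where
    open WeightedGraph X

    degree : Fin n → Carrier
    degree i = sum (weight i)

    adjacencyMatrix degreeMatrix laplacian signlessLaplacian : Matrixʳ n
    adjacencyMatrix = weight
    degreeMatrix i j = if does (i ≟ j) then degree i else 0#
    laplacian i j = degreeMatrix i j - adjacencyMatrix i j
    signlessLaplacian i j = degreeMatrix i j + adjacencyMatrix i j

  data MatrixKind : Set where
    A L Q : MatrixKind

  matrixOf : MatrixKind → ∀ {n} → WeightedGraph n → Matrixʳ n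
  matrixOf A = adjacencyMatrix
  matrixOf L = laplacian
  matrixOf Q = signlessLaplacian

  module _ {n} (M : Matrixʳ n) where
    U : Carrier → Matrixᶜ n
    U t = expₘ ((𝕚 *ᶜ ofReal t) ∙ₘ complexify M)

    -- (U(t) 𝕖ᵤ) ∘ (conj U(t) 𝕖ᵤ) − (1/n) 𝟏
    deviation : .{{_ : NonZero n}} → Carrier → Fin n → Vectorᶜ n
    deviation t u j = (U t *ᵥ 𝕖 u) j *ᶜ (conjₘ (U t) *ᵥ 𝕖 u) j -ᶜ ofReal (1/ n)

    LocalεUniformMixing : .{{_ : NonZero n}} → Fin n → Set
    LocalεUniformMixing u = ∀ ε → 0# < ε → ∃[ τ ] ‖ deviation τ u ‖ < ε

    εUniformMixing : .{{_ : NonZero n}} → Set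
    εUniformMixing = ∀ ε → 0# < ε → ∃[ τ ] (∀ u → ‖ deviation τ u ‖ < ε)

    -- v and its eigenvalue μ range over ℂ; this includes the real eigenvectors.
    Eigenvector : Vectorᶜ n → Set
    Eigenvector v = ¬ (∀ j → v j ≈ᶜ 0ᶜ) ×
                    ∃[ μ ] (∀ i → (complexify M *ᵥ v) i ≈ᶜ μ *ᶜ v i)

{-# OPTIONS --safe #-}

-- M is real symmetric, so the eigenvalue μ of v is real and vᵀ U(t) = exp(i t μ) vᵀ with
-- |exp(i t μ)| = 1.  Reading off the u-th entry, |v_u| = |Σ_j v_j U(t)_{ju}|, which is at most
-- Σ_j |v_j| |U(t)_{ju}|; at a time where the u-th column is ε-close to uniform this is at most
-- √(1/n + ε) Σ_j |v_j|, and ε is arbitrary.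
--
-- |exp(iθ)| = 1 is obtained from the Cauchy product of the series of exp(iθ) and of its
-- conjugate exp(−iθ): by the Leibniz rule for formal power series that product is the series
-- of exp(0), and the truncation error is dominated by that of exp(c) exp(c) = exp(2c), c = |θ|.
module Submission where

open import Defs
open import Algebra.Bundles using (CommutativeRing; Semiring)
open import Data.Empty using (⊥-elim)
open import Data.Fin.Base using (Fin; zero; suc)
open import Data.Fin.Properties using (_≟_)
open import Data.Nat.Base as ℕ using (ℕ; zero; suc; NonZero)
open import Data.Product.Base using (_×_; _,_; proj₁; proj₂; ∃-syntax)
open import Data.Sum.Base using ([_,_]′)
open import Level using (0ℓ)
open import Relation.Binary.PropositionalEquality.Core as ≡ using ()
open import Relation.Binary.Structures using (IsPreorder; IsStrictPartialOrder)
open import Relation.Nullary.Decidable.Core using (yes; no)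
open import Relation.Nullary.Negation.Core using (¬_)
import Algebra.Definitions.RawSemiring
import Algebra.Properties.CommutativeSemigroup
import Algebra.Properties.Semiring.Mult
import Algebra.Properties.Semiring.Sum
import Data.Nat.Properties as ℕ
import Relation.Binary.Reasoning.Base.Triple
import Relation.Binary.Reasoning.Setoid

-- The order is not decidable and `x ≤ y` means that `y < x` is refuted, so bounds are proved by
-- contradiction, equalities of reals often by antisymmetry or tightness, and an arbitrary `ε` is
-- removed by `≤-limit` instead of a case distinction. `expₘ` is available only as an entrywise
-- limit. No scalar exponential is formed and no limit is exchanged with a sum: the eigenvector
-- relation holds exactly for every partial sum of the matrix series, and the errors are estimated
-- afterwards. Since `∣ v u ∣` is to be bounded from above, only the lower half of |exp(iθ)| = 1 is
-- required, again for partial sums. Exponential series enter through the recurrence of f′ = z f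
-- rather than through their closed form. This replaces the binomial theorem twice: for exp(c)
-- exp(c) = exp(2c) and for exp(z) exp(conj z) = 1.

-- Formal power series over a commutative ring, and truncated products.

module PowerSeries (CR : CommutativeRing 0ℓ 0ℓ) where
  open CommutativeRing CR hiding (zero)
  open RingSolver CR
  open Algebra.Properties.Semiring.Mult semiring using () renaming (_×_ to _⋅_)
  open Relation.Binary.Reasoning.Setoid setoid

  Sequence : Set
  Sequence = ℕ → Carrier

  shift : Sequence → Sequence
  shift a k = a (suc k)

  series : Sequence → Sequence
  series a zero    = 0#
  series a (suc N) = series a N + a N

  -- Coefficients of the Cauchy product. Splitting off the head of `a` avoids the index m - i and
  -- turns each law into an induction that replaces `a` by `shift a`.
  conv : Sequence → Sequence → Sequence
  conv a b zero    = a 0 * b 0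
  conv a b (suc m) = a 0 * b (suc m) + conv (shift a) b m

  deriv : Sequence → Sequence
  deriv a k = suc k ⋅ 1# * a (suc k)

  -- The coefficients of a solution of f′ = z f, i.e. of a multiple of exp (z x).
  Exponential : Carrier → Sequence → Set
  Exponential z a = ∀ k → deriv a k ≈ z * a k

  conv-cong : ∀ {a a′ b b′} → (∀ k → a k ≈ a′ k) → (∀ k → b k ≈ b′ k) →
              ∀ m → conv a b m ≈ conv a′ b′ m
  conv-cong a≈ b≈ zero    = *-cong (a≈ 0) (b≈ 0)
  conv-cong a≈ b≈ (suc m) =
    +-cong (*-cong (a≈ 0) (b≈ (suc m))) (conv-cong (λ k → a≈ (suc k)) b≈ m)

  conv-+ : ∀ a a′ b m → conv (λ k → a k + a′ k) b m ≈ conv a b m + conv a′ b m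
  conv-+ a a′ b zero    = distribʳ (b 0) (a 0) (a′ 0)
  conv-+ a a′ b (suc m) = trans (+-congˡ (conv-+ (shift a) (shift a′) b m))
    (solve 5 (λ x x′ y c c′ → (x :+ x′) :* y :+ (c :+ c′) := (x :* y :+ c) :+ (x′ :* y :+ c′))
      refl (a 0) (a′ 0) (b (suc m)) (conv (shift a) b m) (conv (shift a′) b m))

  conv-*ˡ : ∀ z a b m → conv (λ k → z * a k) b m ≈ z * conv a b m
  conv-*ˡ z a b zero    = *-assoc z (a 0) (b 0)
  conv-*ˡ z a b (suc m) = trans (+-congˡ (conv-*ˡ z (shift a) b m))
    (solve 4 (λ z x y c → (z :* x) :* y :+ z :* c := z :* (x :* y :+ c))
      refl z (a 0) (b (suc m)) (conv (shift a) b m))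

  conv-*ʳ : ∀ z a b m → conv a (λ k → z * b k) m ≈ z * conv a b m
  conv-*ʳ z a b zero    = solve 3 (λ z x y → x :* (z :* y) := z :* (x :* y)) refl z (a 0) (b 0)
  conv-*ʳ z a b (suc m) = trans (+-congˡ (conv-*ʳ z (shift a) b m))
    (solve 4 (λ z x y c → x :* (z :* y) :+ z :* c := z :* (x :* y :+ c))
      refl z (a 0) (b (suc m)) (conv (shift a) b m))

  -- Write a = a 0 + x a′. Differentiating x times the product of a′ and b leaves one extra copy of
  -- `conv a′ b`; its tail merges with `conv (deriv a′) b`, because `shift (deriv a)` is `shift a′`
  -- plus `deriv a′` by k + 2 = 1 + (k + 1). Its head `a 1 * b (suc m)` becomes the head of
  -- `conv (deriv a) b`.
  leibniz : ∀ a b m → deriv (conv a b) m ≈ conv (deriv a) b m + conv a (deriv b) m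
  leibniz a b zero = solve 5 (λ s a₀ a₁ b₀ b₁ →
      s :* (a₀ :* b₁ :+ a₁ :* b₀) := (s :* a₁) :* b₀ :+ a₀ :* (s :* b₁))
    refl (1 ⋅ 1#) (a 0) (a 1) (b 0) (b 1)
  leibniz a b (suc m) = begin
    (1# + s) * (a 0 * b (2 ℕ.+ m) + conv a′ b (suc m))
      ≈⟨ solve 4 (λ s a₀ b₂ c → (con (1 , 0) :+ s) :* (a₀ :* b₂ :+ c)
           := a₀ :* ((con (1 , 0) :+ s) :* b₂) :+ (c :+ s :* c)) refl s (a 0) (b (2 ℕ.+ m)) (conv a′ b (suc m)) ⟩
    a 0 * deriv b (suc m) + (conv a′ b (suc m) + deriv (conv a′ b) m)
      ≈⟨ +-congˡ (+-congˡ (leibniz a′ b m)) ⟩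
    a 0 * deriv b (suc m) + ((a 1 * b (suc m) + conv (shift a′) b m) + (conv (deriv a′) b m + conv a′ (deriv b) m))
      ≈⟨ solve 5 (λ x y c d e → x :+ ((y :+ c) :+ (d :+ e)) := (y :+ (c :+ d)) :+ (x :+ e))
           refl _ _ _ _ _ ⟩
    (a 1 * b (suc m) + (conv (shift a′) b m + conv (deriv a′) b m)) + conv a (deriv b) (suc m)
      ≈⟨ +-congʳ (+-cong (*-congʳ (solve 1 (λ x → x := (con (1 , 0) :+ con (0 , 0)) :* x) refl (a 1)))
           (trans (sym (conv-+ (shift a′) (deriv a′) b m))
                  (conv-cong (λ k → solve 2 (λ s x → x :+ s :* x := (con (1 , 0) :+ s) :* x) refl (suc k ⋅ 1#) (a (2 ℕ.+ k)))
                             (λ _ → refl) m))) ⟩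
    conv (deriv a) b (suc m) + conv a (deriv b) (suc m) ∎
    where
    a′ = shift a
    s = suc m ⋅ 1#

  -- The functional equation of the exponential at the level of coefficients: if f′ = z f and g′ = w
  -- g, then (f g)′ = (z + w) f g.
  conv-exponential : ∀ {z w a b} → Exponential z a → Exponential w b → Exponential (z + w) (conv a b)
  conv-exponential {z} {w} {a} {b} a′≈ b′≈ m = begin
    deriv (conv a b) m                                        ≈⟨ leibniz a b m ⟩
    conv (deriv a) b m + conv a (deriv b) m                   ≈⟨ +-cong (conv-cong a′≈ (λ _ → refl) m) (conv-cong (λ _ → refl) b′≈ m) ⟩
    conv (λ k → z * a k) b m + conv a (λ k → w * b k) m       ≈⟨ +-cong (conv-*ˡ z a b m) (conv-*ʳ w a b m) ⟩
    z * conv a b m + w * conv a b m                           ≈⟨ distribʳ (conv a b m) z w ⟨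
    (z + w) * conv a b m                                      ∎

  series-cong : ∀ {a b} → (∀ k → a k ≈ b k) → ∀ N → series a N ≈ series b N
  series-cong a≈b zero    = refl
  series-cong a≈b (suc N) = +-cong (series-cong a≈b N) (a≈b N)

  series-suc : ∀ a N → series a (suc N) ≈ a 0 + series (shift a) N
  series-suc a zero    = +-comm 0# (a 0)
  series-suc a (suc N) = trans (+-congʳ (series-suc a N)) (+-assoc (a 0) (series (shift a) N) (a (suc N)))

  series-conv-suc : ∀ a b N →
    series (conv a b) (suc N) ≈ a 0 * series b (suc N) + series (conv (shift a) b) N
  series-conv-suc a b zero    =
    solve 2 (λ x y → con (0 , 0) :+ x :* y := x :* (con (0 , 0) :+ y) :+ con (0 , 0)) refl (a 0) (b 0)
  series-conv-suc a b (suc N) = trans (+-congʳ (series-conv-suc a b N))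
    (solve 5 (λ x s y c d → (x :* s :+ c) :+ (x :* y :+ d) := x :* (s :+ y) :+ (c :+ d))
      refl (a 0) (series b (suc N)) (b (suc N)) (series (conv (shift a) b) N) (conv (shift a) b N))

  -- The rectangle i < p, j < q of products minus the triangle i + j < p. The two lengths are kept
  -- apart because removing the row of `a 0` lowers `p` but not `q`; the application has p = q.
  productError : Sequence → Sequence → ℕ → ℕ → Carrier
  productError a b p q = series a p * series b q - series (conv a b) p

  productError-zero : ∀ a b q → productError a b 0 q ≈ 0#
  productError-zero a b q = solve 1 (λ x → con (0 , 0) :* x :- con (0 , 0) := con (0 , 0)) refl (series b q)

  productError-suc : ∀ a b p q →
    productError a b (suc p) q ≈ a 0 * (series b q - series b (suc p)) + productError (shift a) b p q
  productError-suc a b p q = trans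
    (+-cong (*-congʳ (series-suc a p)) (-‿cong (series-conv-suc a b p)))
    (solve 5 (λ x s t t′ c → (x :+ s) :* t :- (x :* t′ :+ c) := x :* (t :- t′) :+ (s :* t :- c))
      refl (a 0) (series (shift a) p) (series b q) (series b (suc p)) (series (conv (shift a) b) p))

  series-tail-suc : ∀ a p q → series a (suc q) - series a p ≈ (series a q - series a p) + a q
  series-tail-suc a p q =
    solve 3 (λ x y z → (x :+ y) :- z := (x :- z) :+ y) refl (series a q) (a q) (series a p)

-- Order, limits of inequalities, and square roots of reals.

module OrderedField (R : RealNumbers) where
  open Reals R
  open RingSolver commutativeRing

  ≤-isPreorder : IsPreorder _≈_ _≤_
  ≤-isPreorder = record { isEquivalence = isEquivalence ; reflexive = ≤-reflexive ; trans = ≤-trans }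

  module ≤-Reasoning = Relation.Binary.Reasoning.Base.Triple ≤-isPreorder
    (λ x<y y<x → <⇒≤ x<y y<x) <-trans (IsStrictPartialOrder.<-resp-≈ <-isStrictPartialOrder)
    <⇒≤ <-≤-trans ≤-<-trans
  open ≤-Reasoning

  ≤-antisym : ∀ {x y} → x ≤ y → y ≤ x → x ≈ y
  ≤-antisym {x} {y} x≤y y≤x = proj₁ (tight x y) λ x#y → [ y≤x , x≤y ]′ (#⇒<⊎> x#y)

  +-mono-≤ : ∀ {x y z w} → x ≤ y → z ≤ w → x + z ≤ y + w
  +-mono-≤ {x} {y} {z} {w} x≤y z≤w = ≤-by (≤-+ (≤-diff x≤y) (≤-diff z≤w))
    (solve 4 (λ x y z w → y :+ w := (x :+ z) :+ ((y :- x) :+ (w :- z))) refl x y z w)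

  *-monoˡ-≤ : ∀ {p x y} → 0# ≤ p → x ≤ y → x * p ≤ y * p
  *-monoˡ-≤ {p} {x} {y} 0≤p x≤y = begin
    x * p  ≈⟨ *-comm x p ⟩
    p * x  ≤⟨ *-monoʳ-≤ 0≤p x≤y ⟩
    p * y  ≈⟨ *-comm p y ⟩
    y * p  ∎

  *-mono-≤ : ∀ {x y z w} → 0# ≤ x → 0# ≤ w → x ≤ y → z ≤ w → x * z ≤ y * w
  *-mono-≤ 0≤x 0≤w x≤y z≤w = ≤-trans (*-monoʳ-≤ 0≤x z≤w) (*-monoˡ-≤ 0≤w x≤y)

  sum-mono-≤ : ∀ {n} (f g : Fin n → Carrier) → (∀ i → f i ≤ g i) → sum f ≤ sum g
  sum-mono-≤ {zero}  f g f≤g = 0≤0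
  sum-mono-≤ {suc n} f g f≤g = +-mono-≤ (f≤g zero) (sum-mono-≤ (λ i → f (suc i)) (λ i → g (suc i)) (λ i → f≤g (suc i)))

  square-cancel-≤ : ∀ {x y} → 0# ≤ y → x * x ≤ y * y → x ≤ y
  square-cancel-≤ {x} {y} 0≤y x²≤y² y<x = x²≤y² (begin-strict
    y * y  ≤⟨ *-monoʳ-≤ 0≤y (<⇒≤ y<x) ⟩
    y * x  ≈⟨ *-comm y x ⟩
    x * y  <⟨ *-monoʳ-< (≤-<-trans 0≤y y<x) y<x ⟩
    x * x  ∎)

  square-cancel-≈ : ∀ {x y} → 0# ≤ x → 0# ≤ y → x * x ≈ y * y → x ≈ y
  square-cancel-≈ 0≤x 0≤y x²≈y² = ≤-antisym
    (square-cancel-≤ 0≤y (≤-reflexive x²≈y²)) (square-cancel-≤ 0≤x (≤-reflexive (sym x²≈y²)))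

  -- If y < x, then ε = (x - y)/(K + 1) gives y + K ε = x - ε < x, a contradiction. The summand 1
  -- keeps the denominator positive when `K` is 0. With `K` as a parameter, estimates can be used
  -- without rescaling `ε`.
  ≤-limit : ∀ {x y} K → 0# ≤ K → (∀ ε → 0# < ε → x ≤ y + K * ε) → x ≤ y
  ≤-limit {x} {y} K 0≤K x≤ y<x = x≤ (d * q) 0<dq (<-by 0<dq
      (trans (solve 2 (λ x y → x := y :+ (x :- y) :* con (1 , 0)) refl x y)
      (trans (+-congˡ (*-congˡ (sym (*-inv p#0))))
      (solve 4 (λ y d K q → y :+ d :* ((K :+ con (1 , 0)) :* q) := (y :+ K :* (d :* q)) :+ d :* q) refl y d K q))))
    where
    d = x - y
    0<p : 0# < K + 1#
    0<p = <-respʳ-≈ (+-comm 1# K) (<-≤-+ 0<1 0≤K)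
    p#0 : (K + 1#) # 0#
    p#0 = #-sym (<⇒# 0<p)
    q = inv p#0
    0<dq : 0# < d * q
    0<dq = *-pos (<-diff y<x) (inv-pos 0<p p#0)

  0≤√ : ∀ x → 0# ≤ √ x
  0≤√ x = proj₁ (√-supremum x) 0# (SquareRoot.below-0 x)

  ≤√ : ∀ {x y} → y * y ≤ x → y ≤ √ x
  ≤√ {x} {y} y²≤x = proj₁ (√-supremum x) y (λ _ → y²≤x)

  √-square : ∀ {x} → 0# ≤ x → √ x * √ x ≈ x
  √-square {x} 0≤x = ≤-antisym s²≤x x≤s²
    where
    s = √ x
    0≤s : 0# ≤ s
    0≤s = 0≤√ x

    -- Some z ∈ Below exceeds the Heron iterate (s² + x)/2s < s, which contradicts (s − z)² ≥ 0.
    s²≤x : s * s ≤ x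
    s²≤x x<s² = <-irrefl (sym (trans (*-congʳ s≈0) (zeroˡ s))) (≤-<-trans 0≤x x<s²)
      where
      ¬0<s : ¬ (0# < s)
      ¬0<s 0<s = 0≤x² (s - z) (begin-strict
        (s - z) * (s - z)            ≈⟨ solve 2 (λ s z → (s :- z) :* (s :- z) := (s :* s :- (s :+ s) :* z) :+ z :* z) refl s z ⟩
        (s * s - (s + s) * z) + z * z  ≤⟨ +-mono-≤ (≤-reflexive refl) (z∈Below 0<z) ⟩
        (s * s - (s + s) * z) + x    ≈⟨ solve 3 (λ s z x → (s :* s :- (s :+ s) :* z) :+ x := (s :* s :+ x) :- (s :+ s) :* z) refl s z x ⟩
        (s * s + x) - (s + s) * z    ≈⟨ +-congʳ 2sy≈s²+x ⟨
        (s + s) * y - (s + s) * z    <⟨ +-monoˡ-< (- ((s + s) * z)) (*-monoʳ-< 0<2s y<z) ⟩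
        (s + s) * z - (s + s) * z    ≈⟨ -‿inverseʳ _ ⟩
        0#                           ∎)
        where
        0<2s : 0# < s + s
        0<2s = <-≤-+ 0<s 0≤s
        2s#0 : (s + s) # 0#
        2s#0 = #-sym (<⇒# 0<2s)
        y = (s * s + x) * inv 2s#0
        2sy≈s²+x : (s + s) * y ≈ s * s + x
        2sy≈s²+x = trans (solve 3 (λ p c q → p :* (c :* q) := c :* (p :* q)) refl (s + s) (s * s + x) (inv 2s#0))
          (trans (*-congˡ (*-inv 2s#0)) (*-identityʳ _))
        y<s : y < s
        y<s = *-cancelˡ-< 0<2s (<-respˡ-≈ (sym 2sy≈s²+x) (<-by (<-diff x<s²)
          (solve 2 (λ s x → (s :+ s) :* s := (s :* s :+ x) :+ (s :* s :- x)) refl s x)))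
        0<y : 0# < y
        0<y = *-pos (<-≤-+ (*-pos 0<s 0<s) 0≤x) (inv-pos 0<2s 2s#0)
        member = proj₂ (√-supremum x) y y<s
        z = proj₁ member
        z∈Below : SquareRoot.Below x z
        z∈Below = proj₁ (proj₂ member)
        y<z : y < z
        y<z = proj₂ (proj₂ member)
        0<z : 0# < z
        0<z = <-trans 0<y y<z
      -- Whether 0 < s holds cannot be decided, so it is refuted under the assumption x < s². What
      -- remains is s ≈ 0, which would make x negative.
      s≈0 : s ≈ 0#
      s≈0 = ≤-antisym ¬0<s 0≤s

    -- If d = x - s² were positive, s + δ with δ = d/(1 + 2s + d) would still have its square below
    -- x, although s bounds all such numbers. Substituting d = δ q a second time, in the term δ d,
    -- supplies the δ² of the expanded square and leaves the non-negative remainder δ(1 + δ(2s +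
    -- d)).
    x≤s² : x ≤ s * s
    x≤s² s²<x = ≤√ (≤-by (*-nonneg (<⇒≤ 0<δ) (≤-+ (<⇒≤ 0<1) (*-nonneg (<⇒≤ 0<δ) (≤-+ (≤-+ 0≤s 0≤s) (<⇒≤ 0<d))))) (begin-equality
        x                                                ≈⟨ solve 2 (λ x s → x := s :* s :+ (x :- s :* s)) refl x s ⟩
        s * s + d                                        ≈⟨ +-congˡ δq≈d ⟨
        s * s + δ * q                                    ≈⟨ solve 3 (λ s δ d → s :* s :+ δ :* (con (1 , 0) :+ ((s :+ s) :+ d))
                                                              := (s :* s :+ δ :* (con (1 , 0) :+ (s :+ s))) :+ δ :* d) refl s δ d ⟩
        (s * s + δ * (1# + (s + s))) + δ * d             ≈⟨ +-congˡ (*-congˡ δq≈d) ⟨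
        (s * s + δ * (1# + (s + s))) + δ * (δ * q)       ≈⟨ solve 3 (λ s δ d → let one = con (1 , 0) in
                                                              (s :* s :+ δ :* (one :+ (s :+ s))) :+ δ :* (δ :* (one :+ ((s :+ s) :+ d)))
                                                              := (s :+ δ) :* (s :+ δ) :+ δ :* (one :+ δ :* ((s :+ s) :+ d))) refl s δ d ⟩
        (s + δ) * (s + δ) + δ * (1# + δ * ((s + s) + d)) ∎))
      (<-by 0<δ refl)
      where
      d = x - s * s
      0<d : 0# < d
      0<d = <-diff s²<x
      q = 1# + ((s + s) + d)
      0<q : 0# < q
      0<q = <-≤-+ 0<1 (≤-+ (≤-+ 0≤s 0≤s) (<⇒≤ 0<d))
      q#0 : q # 0#
      q#0 = #-sym (<⇒# 0<q)
      δ = d * inv q#0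
      0<δ : 0# < δ
      0<δ = *-pos 0<d (inv-pos 0<q q#0)
      δq≈d : δ * q ≈ d
      δq≈d = trans (solve 3 (λ d i q → (d :* i) :* q := d :* (q :* i)) refl d (inv q#0) q)
        (trans (*-congˡ (*-inv q#0)) (*-identityʳ d))

  √≤ : ∀ {x y} → 0# ≤ x → 0# ≤ y → x ≤ y * y → √ x ≤ y
  √≤ 0≤x 0≤y x≤y² = square-cancel-≤ 0≤y (≤-respˡ-≈ (sym (√-square 0≤x)) x≤y²)

  √-mono-≤ : ∀ {x y} → 0# ≤ x → x ≤ y → √ x ≤ √ y
  √-mono-≤ 0≤x x≤y = √≤ 0≤x (0≤√ _) (≤-respʳ-≈ (sym (√-square (≤-trans 0≤x x≤y))) x≤y)

  x²≈0⇒x≈0 : ∀ {x} → x * x ≈ 0# → x ≈ 0#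
  x²≈0⇒x≈0 {x} x²≈0 = ≤-antisym
    (square-cancel-≤ 0≤0 (≤-reflexive x²≈0²))
    (λ x<0 → square-cancel-≤ 0≤0
      (≤-reflexive (trans (solve 1 (λ x → :- x :* :- x := x :* x) refl x) x²≈0²)) (neg-pos x<0))
    where
    x²≈0² : x * x ≈ 0# * 0#
    x²≈0² = trans x²≈0 (sym (zeroˡ 0#))

-- Complex numbers: ring structure, modulus and finite sums.

module Complex (R : RealNumbers) where
  open Reals R
  open OrderedField R
  open RingSolver commutativeRing
  open ≤-Reasoning

  -- Packaged as a bundle so that the power series laws apply to complex coefficients as well as to
  -- the real sequences that dominate them.
  ℂ-commutativeRing : CommutativeRing 0ℓ 0ℓ
  ℂ-commutativeRing = record
    { Carrier = ℂ
    ; _≈_ = _≈ᶜ_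
    ; _+_ = _+ᶜ_
    ; _*_ = _*ᶜ_
    ; -_  = λ z → (- re z) +i (- im z)
    ; 0#  = 0ᶜ
    ; 1#  = 1ᶜ
    ; isCommutativeRing = record
      { isRing = record
        { +-isAbelianGroup = record
          { isGroup = record
            { isMonoid = record
              { isSemigroup = record
                { isMagma = record
                  { isEquivalence = record
                    { refl  = refl , refl
                    ; sym   = λ (p , q) → sym p , sym q
                    ; trans = λ (p , q) (p′ , q′) → trans p p′ , trans q q′
                    }
                  ; ∙-cong = λ (p , q) (p′ , q′) → +-cong p p′ , +-cong q q′
                  }
                ; assoc = λ z w t → +-assoc _ _ _ , +-assoc _ _ _
                }
              ; identity = (λ z → +-identityˡ _ , +-identityˡ _) , (λ z → +-identityʳ _ , +-identityʳ _)
              }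
            ; inverse = (λ z → -‿inverseˡ _ , -‿inverseˡ _) , (λ z → -‿inverseʳ _ , -‿inverseʳ _)
            ; ⁻¹-cong = λ (p , q) → -‿cong p , -‿cong q
            }
          ; comm = λ z w → +-comm _ _ , +-comm _ _
          }
        ; *-cong = *ᶜ-cong
        ; *-assoc = λ (a +i b) (c +i d) (e +i f) →
            solve 6 (λ a b c d e f → (a :* c :- b :* d) :* e :- (a :* d :+ b :* c) :* f
                                  := a :* (c :* e :- d :* f) :- b :* (c :* f :+ d :* e)) refl a b c d e f
          , solve 6 (λ a b c d e f → (a :* c :- b :* d) :* f :+ (a :* d :+ b :* c) :* e
                                  := a :* (c :* f :+ d :* e) :+ b :* (c :* e :- d :* f)) refl a b c d e f
        ; *-identity = (λ z → trans (*ᶜ-comm-re 1ᶜ z) (proj₁ (identity z)) , trans (*ᶜ-comm-im 1ᶜ z) (proj₂ (identity z)))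
                     , identity
        ; distrib = (λ (a +i b) (c +i d) (e +i f) →
              solve 6 (λ a b c d e f → a :* (c :+ e) :- b :* (d :+ f) := (a :* c :- b :* d) :+ (a :* e :- b :* f)) refl a b c d e f
            , solve 6 (λ a b c d e f → a :* (d :+ f) :+ b :* (c :+ e) := (a :* d :+ b :* c) :+ (a :* f :+ b :* e)) refl a b c d e f)
          , (λ (a +i b) (c +i d) (e +i f) →
              solve 6 (λ a b c d e f → (c :+ e) :* a :- (d :+ f) :* b := (c :* a :- d :* b) :+ (e :* a :- f :* b)) refl a b c d e f
            , solve 6 (λ a b c d e f → (c :+ e) :* b :+ (d :+ f) :* a := (c :* b :+ d :* a) :+ (e :* b :+ f :* a)) refl a b c d e f)
        }
      ; *-comm = λ z w → *ᶜ-comm-re z w , *ᶜ-comm-im z w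
      }
    }
    where
    *ᶜ-cong : ∀ {z z′ w w′} → z ≈ᶜ z′ → w ≈ᶜ w′ → z *ᶜ w ≈ᶜ z′ *ᶜ w′
    *ᶜ-cong (p , q) (p′ , q′) = +-cong (*-cong p p′) (-‿cong (*-cong q q′)) , +-cong (*-cong p q′) (*-cong q p′)
    *ᶜ-comm-re : ∀ z w → re (z *ᶜ w) ≈ re (w *ᶜ z)
    *ᶜ-comm-re (a +i b) (c +i d) = solve 4 (λ a b c d → a :* c :- b :* d := c :* a :- d :* b) refl a b c d
    *ᶜ-comm-im : ∀ z w → im (z *ᶜ w) ≈ im (w *ᶜ z)
    *ᶜ-comm-im (a +i b) (c +i d) = solve 4 (λ a b c d → a :* d :+ b :* c := c :* b :+ d :* a) refl a b c d
    identity : ∀ z → z *ᶜ 1ᶜ ≈ᶜ z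
    identity (a +i b) = solve 2 (λ a b → a :* con (1 , 0) :- b :* con (0 , 0) := a) refl a b
                      , solve 2 (λ a b → a :* con (0 , 0) :+ b :* con (1 , 0) := b) refl a b

  module ℂᵣ = CommutativeRing ℂ-commutativeRing
  open Algebra.Definitions.RawSemiring (Semiring.rawSemiring ℂᵣ.semiring) public
    using () renaming (_^_ to _^ᶜ_; _×_ to _⋅ᶜ_)
  module ℂR = Relation.Binary.Reasoning.Setoid ℂᵣ.setoid
  open Algebra.Properties.CommutativeSemigroup ℂᵣ.*-commutativeSemigroup public using (x∙yz≈y∙xz)
  module ℝΣ = Algebra.Properties.Semiring.Sum semiring
  private
    module ℂΣ = Algebra.Properties.Semiring.Sum ℂᵣ.semiring

  ofReal-* : ∀ x y → ofReal x *ᶜ ofReal y ≈ᶜ ofReal (x * y)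
  ofReal-* x y = solve 2 (λ x y → x :* y :- con (0 , 0) :* con (0 , 0) := x :* y) refl x y
               , solve 2 (λ x y → x :* con (0 , 0) :+ con (0 , 0) :* y := con (0 , 0)) refl x y

  ofReal-*ˡ : ∀ x z → ofReal x *ᶜ z ≈ᶜ x * re z +i x * im z
  ofReal-*ˡ x (a +i b) = solve 3 (λ x a b → x :* a :- con (0 , 0) :* b := x :* a) refl x a b
                       , solve 3 (λ x a b → x :* b :+ con (0 , 0) :* a := x :* b) refl x a b

  ofReal-⋅1 : ∀ n → n ⋅ᶜ 1ᶜ ≈ᶜ ofReal (n ⋅ 1#)
  ofReal-⋅1 zero    = ℂᵣ.refl
  ofReal-⋅1 (suc n) = ℂᵣ.trans (ℂᵣ.+-congˡ {1ᶜ} (ofReal-⋅1 n)) (refl , +-identityʳ 0#)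

  conj-* : ∀ z w → conj (z *ᶜ w) ≈ᶜ conj z *ᶜ conj w
  conj-* (a +i b) (c +i d) =
      solve 4 (λ a b c d → a :* c :- b :* d := a :* c :- :- b :* :- d) refl a b c d
    , solve 4 (λ a b c d → :- (a :* d :+ b :* c) := a :* :- d :+ :- b :* c) refl a b c d

  conj-cong : ∀ {z w} → z ≈ᶜ w → conj z ≈ᶜ conj w
  conj-cong (p , q) = p , -‿cong q

  conj-ofReal : ∀ x → conj (ofReal x) ≈ᶜ ofReal x
  conj-ofReal x = refl , solve 0 (:- con (0 , 0) := con (0 , 0)) refl

  *-conj : ∀ z → z *ᶜ conj z ≈ᶜ ofReal (normSq z)
  *-conj (a +i b) = solve 2 (λ a b → a :* a :- b :* :- b := a :* a :+ b :* b) refl a b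
                  , solve 2 (λ a b → a :* :- b :+ b :* a := con (0 , 0)) refl a b

  0≤normSq : ∀ z → 0# ≤ normSq z
  0≤normSq z = ≤-+ (0≤x² (re z)) (0≤x² (im z))

  0≤∣∣ : ∀ z → 0# ≤ ∣ z ∣
  0≤∣∣ z = 0≤√ (normSq z)

  ∣∣-square : ∀ z → ∣ z ∣ * ∣ z ∣ ≈ normSq z
  ∣∣-square z = √-square (0≤normSq z)

  ∣∣≤⇐ : ∀ {z b} → 0# ≤ b → normSq z ≤ b * b → ∣ z ∣ ≤ b
  ∣∣≤⇐ {z} 0≤b = √≤ (0≤normSq z) 0≤b

  normSq-cong : ∀ {z w} → z ≈ᶜ w → normSq z ≈ normSq w
  normSq-cong (p , q) = +-cong (*-cong p p) (*-cong q q)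

  ∣∣-cong : ∀ {z w} → z ≈ᶜ w → ∣ z ∣ ≈ ∣ w ∣
  ∣∣-cong {z} {w} z≈w = square-cancel-≈ (0≤∣∣ z) (0≤∣∣ w)
    (trans (∣∣-square z) (trans (normSq-cong z≈w) (sym (∣∣-square w))))

  ∣∣-* : ∀ z w → ∣ z *ᶜ w ∣ ≈ ∣ z ∣ * ∣ w ∣
  ∣∣-* z w = square-cancel-≈ (0≤∣∣ _) (*-nonneg (0≤∣∣ z) (0≤∣∣ w)) (begin-equality
    ∣ z *ᶜ w ∣ * ∣ z *ᶜ w ∣                  ≈⟨ ∣∣-square (z *ᶜ w) ⟩
    normSq (z *ᶜ w)                          ≈⟨ solve 4 (λ a b c d →
                                                  (a :* c :- b :* d) :* (a :* c :- b :* d) :+ (a :* d :+ b :* c) :* (a :* d :+ b :* c)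
                                                  := (a :* a :+ b :* b) :* (c :* c :+ d :* d)) refl (re z) (im z) (re w) (im w) ⟩
    normSq z * normSq w                      ≈⟨ *-cong (∣∣-square z) (∣∣-square w) ⟨
    (∣ z ∣ * ∣ z ∣) * (∣ w ∣ * ∣ w ∣)        ≈⟨ solve 2 (λ p q → (p :* p) :* (q :* q) := (p :* q) :* (p :* q)) refl ∣ z ∣ ∣ w ∣ ⟩
    (∣ z ∣ * ∣ w ∣) * (∣ z ∣ * ∣ w ∣)        ∎)

  ∣ofReal∣ : ∀ {x} → 0# ≤ x → ∣ ofReal x ∣ ≈ x
  ∣ofReal∣ {x} 0≤x = square-cancel-≈ (0≤∣∣ _) 0≤x
    (trans (∣∣-square (ofReal x)) (solve 1 (λ x → x :* x :+ con (0 , 0) :* con (0 , 0) := x :* x) refl x))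

  ∣conj∣ : ∀ z → ∣ conj z ∣ ≈ ∣ z ∣
  ∣conj∣ z = square-cancel-≈ (0≤∣∣ _) (0≤∣∣ z) (trans (∣∣-square (conj z))
    (trans (solve 2 (λ a b → a :* a :+ :- b :* :- b := a :* a :+ b :* b) refl (re z) (im z)) (sym (∣∣-square z))))

  ∣-∣ : ∀ z → ∣ ℂᵣ.- z ∣ ≈ ∣ z ∣
  ∣-∣ z = square-cancel-≈ (0≤∣∣ _) (0≤∣∣ z) (trans (∣∣-square (ℂᵣ.- z))
    (trans (solve 2 (λ a b → :- a :* :- a :+ :- b :* :- b := a :* a :+ b :* b) refl (re z) (im z)) (sym (∣∣-square z))))

  re≤∣∣ : ∀ z → re z ≤ ∣ z ∣
  re≤∣∣ z = ≤√ (≤-by (0≤x² (im z)) refl)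

  triangle : ∀ z w → ∣ z +ᶜ w ∣ ≤ ∣ z ∣ + ∣ w ∣
  triangle z w = ∣∣≤⇐ {z +ᶜ w} (≤-+ (0≤∣∣ z) (0≤∣∣ w)) (begin
    normSq (z +ᶜ w)                                           ≈⟨ solve 4 (λ a b c d → (a :+ c) :* (a :+ c) :+ (b :+ d) :* (b :+ d)
                                                                   := ((a :* a :+ b :* b) :+ (c :* c :+ d :* d)) :+ ((a :* c :- b :* :- d) :+ (a :* c :- b :* :- d)))
                                                                   refl (re z) (im z) (re w) (im w) ⟩
    (normSq z + normSq w) + (re zw̄ + re zw̄)                   ≤⟨ +-mono-≤ (≤-reflexive refl) (+-mono-≤ re≤ re≤) ⟩
    (normSq z + normSq w) + (∣ z ∣ * ∣ w ∣ + ∣ z ∣ * ∣ w ∣)   ≈⟨ +-congʳ (+-cong (∣∣-square z) (∣∣-square w)) ⟨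
    (∣ z ∣ * ∣ z ∣ + ∣ w ∣ * ∣ w ∣) + (∣ z ∣ * ∣ w ∣ + ∣ z ∣ * ∣ w ∣)
      ≈⟨ solve 2 (λ p q → (p :* p :+ q :* q) :+ (p :* q :+ p :* q) := (p :+ q) :* (p :+ q)) refl ∣ z ∣ ∣ w ∣ ⟩
    (∣ z ∣ + ∣ w ∣) * (∣ z ∣ + ∣ w ∣)                         ∎)
    where
    zw̄ = z *ᶜ conj w
    re≤ : re zw̄ ≤ ∣ z ∣ * ∣ w ∣
    re≤ = ≤-respʳ-≈ (trans (∣∣-* z (conj w)) (*-congˡ (∣conj∣ w))) (re≤∣∣ zw̄)

  ∣∣-sum : ∀ {n} (z : Fin n → ℂ) → ∣ sumᶜ z ∣ ≤ sum (λ j → ∣ z j ∣)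
  ∣∣-sum {zero}  z = ≤-reflexive (∣ofReal∣ 0≤0)
  ∣∣-sum {suc n} z = ≤-trans (triangle (z zero) (sumᶜ (λ j → z (suc j))))
    (+-mono-≤ (≤-reflexive refl) (∣∣-sum (λ j → z (suc j))))

  -- The factor 2 instead of √2 keeps roots out of the estimate; it is used only for errors that
  -- tend to 0.
  ∣∣-components : ∀ {x y b} → ∣ x ∣≤ b → ∣ y ∣≤ b → ∣ x +i y ∣ ≤ b + b
  ∣∣-components {x} {y} {b} x≤b y≤b = ∣∣≤⇐ {x +i y} (≤-+ 0≤b 0≤b) (begin
    x * x + y * y                      ≤⟨ +-mono-≤ (square≤ x≤b) (square≤ y≤b) ⟩
    b * b + b * b                      ≤⟨ ≤-by (≤-+ (0≤x² b) (0≤x² b)) (solve 1 (λ b → (b :+ b) :* (b :+ b) := (b :* b :+ b :* b) :+ (b :* b :+ b :* b)) refl b) ⟩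
    (b + b) * (b + b)                  ∎)
    where
    square≤ : ∀ {x} → ∣ x ∣≤ b → x * x ≤ b * b
    square≤ {x} (p , q) = ≤-by (*-nonneg p q) (solve 2 (λ x b → b :* b := x :* x :+ (b :- x) :* (b :+ x)) refl x b)
    0≤b : 0# ≤ b
    0≤b b<0 = ≤-+ (proj₁ x≤b) (proj₂ x≤b) (begin-strict
      (b - x) + (b + x)  ≈⟨ solve 2 (λ b x → (b :- x) :+ (b :+ x) := b :+ b) refl b x ⟩
      b + b              <⟨ +-monoˡ-< b b<0 ⟩
      0# + b             ≈⟨ +-identityˡ b ⟩
      b                  <⟨ b<0 ⟩
      0#                 ∎)

  sumᶜ-cong : ∀ {n} {z w : Fin n → ℂ} → (∀ j → z j ≈ᶜ w j) → sumᶜ z ≈ᶜ sumᶜ w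
  sumᶜ-cong z≈w = ℝΣ.sum-cong-≋ (λ j → proj₁ (z≈w j)) , ℝΣ.sum-cong-≋ (λ j → proj₂ (z≈w j))

  sumᶜ-+ : ∀ {n} (z w : Fin n → ℂ) → sumᶜ (λ j → z j +ᶜ w j) ≈ᶜ sumᶜ z +ᶜ sumᶜ w
  sumᶜ-+ z w = ℝΣ.∑-distrib-+ (λ j → re (z j)) (λ j → re (w j)) , ℝΣ.∑-distrib-+ (λ j → im (z j)) (λ j → im (w j))

  sumᶜ-comm : ∀ {m n} (z : Fin m → Fin n → ℂ) →
              sumᶜ (λ i → sumᶜ (λ j → z i j)) ≈ᶜ sumᶜ (λ j → sumᶜ (λ i → z i j))
  sumᶜ-comm z = ℝΣ.∑-comm (λ i j → re (z i j)) , ℝΣ.∑-comm (λ i j → im (z i j))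

  private
    sumᶜ≈sum : ∀ {n} (z : Fin n → ℂ) → sumᶜ z ≈ᶜ ℂΣ.sum z
    sumᶜ≈sum {zero}  z = ℂᵣ.refl
    sumᶜ≈sum {suc n} z = ℂᵣ.+-congˡ {z zero} (sumᶜ≈sum (λ j → z (suc j)))

  *-distribˡ-sumᶜ : ∀ {n} w (z : Fin n → ℂ) → w *ᶜ sumᶜ z ≈ᶜ sumᶜ (λ j → w *ᶜ z j)
  *-distribˡ-sumᶜ w z = ℂᵣ.trans (ℂᵣ.*-congˡ {w} (sumᶜ≈sum z))
    (ℂᵣ.trans (ℂΣ.*-distribˡ-sum w z) (ℂᵣ.sym (sumᶜ≈sum (λ j → w *ᶜ z j))))

  sumᶜ-0 : ∀ {n} (z : Fin n → ℂ) → (∀ j → z j ≈ᶜ 0ᶜ) → sumᶜ z ≈ᶜ 0ᶜ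
  sumᶜ-0 {zero}  z z≈0 = ℂᵣ.refl
  sumᶜ-0 {suc n} z z≈0 = ℂᵣ.trans (ℂᵣ.+-cong (z≈0 zero) (sumᶜ-0 (λ j → z (suc j)) (λ j → z≈0 (suc j)))) (ℂᵣ.+-identityˡ 0ᶜ)

  sumᶜ-𝕖 : ∀ {n} (z : Fin n → ℂ) u → sumᶜ (λ j → z j *ᶜ 𝕖 u j) ≈ᶜ z u
  sumᶜ-𝕖 z zero    = ℂᵣ.trans (ℂᵣ.+-cong (ℂᵣ.*-identityʳ (z zero)) (sumᶜ-0 _ (λ j → ℂᵣ.zeroʳ (z (suc j))))) (ℂᵣ.+-identityʳ (z zero))
  sumᶜ-𝕖 z (suc u) = ℂᵣ.trans (ℂᵣ.+-cong (ℂᵣ.zeroʳ (z zero)) (sumᶜ-𝕖 (λ j → z (suc j)) u)) (ℂᵣ.+-identityˡ (z (suc u)))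

-- Exponential series and the modulus of exp at imaginary arguments.

module Exponentials (R : RealNumbers) where
  open Reals R
  open OrderedField R
  open Complex R
  open RingSolver commutativeRing
  open ≤-Reasoning
  open PowerSeries commutativeRing
  module ℂSeries = PowerSeries ℂ-commutativeRing

  series≈partialSum : ∀ a N → series a N ≈ partialSum a N
  series≈partialSum a zero    = refl
  series≈partialSum a (suc N) = +-congʳ (series≈partialSum a N)

  series-mono-≤ : ∀ {a} → (∀ k → 0# ≤ a k) → ∀ {p q} → p ℕ.≤ q → series a p ≤ series a q
  -- `≤′` grows at its upper end, as `series` does when a last term is added.
  series-mono-≤ {a} 0≤a {p} p≤q = go (ℕ.≤⇒≤′ p≤q)
    where
    go : ∀ {q} → p ℕ.≤′ q → series a p ≤ series a q
    go (ℕ.≤′-refl) = ≤-reflexive refl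
    go (ℕ.≤′-step p≤q) = ≤-trans (go p≤q) (≤-by (0≤a _) refl)

  0≤series : ∀ {a} → (∀ k → 0# ≤ a k) → ∀ N → 0# ≤ series a N
  0≤series 0≤a N = series-mono-≤ 0≤a {0} {N} ℕ.z≤n

  -- The rectangle i < p, j < q lies in the triangle i + j < p + q, and every product is
  -- non-negative.
  series-*-series≤ : ∀ {a b} → (∀ k → 0# ≤ a k) → (∀ k → 0# ≤ b k) →
    ∀ p q → series a p * series b q ≤ series (conv a b) (p ℕ.+ q)
  series-*-series≤ {a} {b} 0≤a 0≤b zero q = begin
    0# * series b q      ≈⟨ zeroˡ _ ⟩
    0#                   ≤⟨ 0≤series (0≤conv 0≤a) q ⟩
    series (conv a b) q  ∎
    where
    0≤conv : ∀ {a} → (∀ k → 0# ≤ a k) → ∀ k → 0# ≤ conv a b k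
    0≤conv 0≤a zero    = *-nonneg (0≤a 0) (0≤b 0)
    0≤conv 0≤a (suc k) = ≤-+ (*-nonneg (0≤a 0) (0≤b (suc k))) (0≤conv (λ k → 0≤a (suc k)) k)
  series-*-series≤ {a} {b} 0≤a 0≤b (suc p) q = begin
    series a (suc p) * series b q                                           ≈⟨ *-congʳ (series-suc a p) ⟩
    (a 0 + series (shift a) p) * series b q                                 ≈⟨ distribʳ _ _ _ ⟩
    a 0 * series b q + series (shift a) p * series b q
      ≤⟨ +-mono-≤ (*-monoʳ-≤ (0≤a 0) (series-mono-≤ 0≤b (ℕ.m≤n+m q (suc p))))
                  (series-*-series≤ (λ k → 0≤a (suc k)) 0≤b p q) ⟩
    a 0 * series b (suc p ℕ.+ q) + series (conv (shift a) b) (p ℕ.+ q)      ≈⟨ series-conv-suc a b (p ℕ.+ q) ⟨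
    series (conv a b) (suc p ℕ.+ q)                                         ∎

  module _ {b : ℕ → ℂ} {β : ℕ → Carrier} (b≤β : ∀ k → ∣ b k ∣ ≤ β k) where
    private
      B = ℂSeries.series b

    ∣series∣-tail : ∀ {p q} → p ℕ.≤ q → ∣ B q ℂᵣ.- B p ∣ ≤ series β q - series β p
    ∣series∣-tail {p} p≤q = go (ℕ.≤⇒≤′ p≤q)
      where
      go : ∀ {q} → p ℕ.≤′ q → ∣ B q ℂᵣ.- B p ∣ ≤ series β q - series β p
      go ℕ.≤′-refl = ≤-reflexive (begin-equality
        ∣ B p ℂᵣ.- B p ∣         ≈⟨ ∣∣-cong (ℂᵣ.-‿inverseʳ (B p)) ⟩
        ∣ 0ᶜ ∣                   ≈⟨ ∣ofReal∣ 0≤0 ⟩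
        0#                       ≈⟨ -‿inverseʳ _ ⟨
        series β p - series β p  ∎)
      go (ℕ.≤′-step {q} p≤q) = begin
        ∣ B (suc q) ℂᵣ.- B p ∣           ≈⟨ ∣∣-cong (ℂSeries.series-tail-suc b p q) ⟩
        ∣ (B q ℂᵣ.- B p) +ᶜ b q ∣        ≤⟨ triangle (B q ℂᵣ.- B p) (b q) ⟩
        ∣ B q ℂᵣ.- B p ∣ + ∣ b q ∣       ≤⟨ +-mono-≤ (go p≤q) (b≤β q) ⟩
        (series β q - series β p) + β q  ≈⟨ series-tail-suc β p q ⟨
        series β (suc q) - series β p    ∎

    -- Both sides collect the products a i * b j with i < p, j < q and i + j ≥ p.
    ∣productError∣ : ∀ {a : ℕ → ℂ} {α : ℕ → Carrier} → (∀ k → ∣ a k ∣ ≤ α k) →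
      ∀ {p q} → p ℕ.≤ q → ∣ ℂSeries.productError a b p q ∣ ≤ productError α β p q
    ∣productError∣ {a} {α} a≤α {zero} {q} _ = ≤-reflexive (begin-equality
      ∣ ℂSeries.productError a b 0 q ∣  ≈⟨ ∣∣-cong (ℂSeries.productError-zero a b q) ⟩
      ∣ 0ᶜ ∣                            ≈⟨ ∣ofReal∣ 0≤0 ⟩
      0#                                ≈⟨ productError-zero α β q ⟨
      productError α β 0 q              ∎)
    ∣productError∣ {a} {α} a≤α {suc p} {q} p<q = begin
      ∣ ℂSeries.productError a b (suc p) q ∣
        ≈⟨ ∣∣-cong (ℂSeries.productError-suc a b p q) ⟩
      ∣ a 0 *ᶜ D +ᶜ ℂSeries.productError (ℂSeries.shift a) b p q ∣
        ≤⟨ triangle (a 0 *ᶜ D) (ℂSeries.productError (ℂSeries.shift a) b p q) ⟩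
      ∣ a 0 *ᶜ D ∣ + ∣ ℂSeries.productError (ℂSeries.shift a) b p q ∣
        ≈⟨ +-congʳ (∣∣-* (a 0) D) ⟩
      ∣ a 0 ∣ * ∣ D ∣ + ∣ ℂSeries.productError (ℂSeries.shift a) b p q ∣
        ≤⟨ +-mono-≤ (*-mono-≤ (0≤∣∣ (a 0)) (≤-trans (0≤∣∣ D) (∣series∣-tail p<q)) (a≤α 0) (∣series∣-tail p<q))
                    (∣productError∣ (λ k → a≤α (suc k)) (ℕ.<⇒≤ p<q)) ⟩
      α 0 * (series β q - series β (suc p)) + productError (shift α) β p q
        ≈⟨ productError-suc α β p q ⟨
      productError α β (suc p) q ∎
      where
      D = B q ℂᵣ.- B (suc p)

  expTerm : ℂ → ℕ → ℂ
  expTerm z k = ofReal (1/! k) *ᶜ z ^ᶜ k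

  1/!-suc : ∀ k → (suc k ⋅ 1#) * 1/! (suc k) ≈ 1/! k
  1/!-suc = ExponentialSeries.1/!-suc 0# 0≤0

  0<1/! : ∀ k → 0# < 1/! k
  0<1/! k = 0<1/ (k ℕ.!) {{k ℕ.!≢0}}

  1/!0≈1 : 1/! 0 ≈ 1#
  1/!0≈1 = trans (solve 1 (λ x → x := (con (1 , 0) :+ con (0 , 0)) :* x) refl (1/! 0)) (*-1/ 1)

  expTerm-exponential : ∀ z → ℂSeries.Exponential z (expTerm z)
  expTerm-exponential z k = ℂR.begin
    suc k ⋅ᶜ 1ᶜ *ᶜ (ofReal (1/! (suc k)) *ᶜ (z *ᶜ z ^ᶜ k))
      ℂR.≈⟨ ℂᵣ.*-assoc (suc k ⋅ᶜ 1ᶜ) (ofReal (1/! (suc k))) (z *ᶜ z ^ᶜ k) ⟨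
    (suc k ⋅ᶜ 1ᶜ *ᶜ ofReal (1/! (suc k))) *ᶜ (z *ᶜ z ^ᶜ k)
      ℂR.≈⟨ ℂᵣ.*-congʳ {z *ᶜ z ^ᶜ k} (ℂᵣ.trans (ℂᵣ.*-congʳ {ofReal (1/! (suc k))} (ofReal-⋅1 (suc k)))
              (ℂᵣ.trans (ofReal-* (suc k ⋅ 1#) (1/! (suc k))) (1/!-suc k , refl))) ⟩
    ofReal (1/! k) *ᶜ (z *ᶜ z ^ᶜ k)
      ℂR.≈⟨ x∙yz≈y∙xz (ofReal (1/! k)) z (z ^ᶜ k) ⟩
    z *ᶜ (ofReal (1/! k) *ᶜ z ^ᶜ k) ℂR.∎

  ∣^∣ : ∀ z k → ∣ z ^ᶜ k ∣ ≈ ∣ z ∣ ^ k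
  ∣^∣ z zero    = ∣ofReal∣ (<⇒≤ 0<1)
  ∣^∣ z (suc k) = trans (∣∣-* z (z ^ᶜ k)) (*-congˡ (∣^∣ z k))

  module _ (z : ℂ) where
    open ExponentialSeries ∣ z ∣ (0≤∣∣ z)

    ∣expTerm∣ : ∀ k → ∣ expTerm z k ∣ ≈ bound k
    ∣expTerm∣ k = begin-equality
      ∣ ofReal (1/! k) *ᶜ z ^ᶜ k ∣        ≈⟨ ∣∣-* (ofReal (1/! k)) (z ^ᶜ k) ⟩
      ∣ ofReal (1/! k) ∣ * ∣ z ^ᶜ k ∣     ≈⟨ *-cong (∣ofReal∣ (<⇒≤ (0<1/! k))) (∣^∣ z k) ⟩
      1/! k * ∣ z ∣ ^ k                   ≈⟨ *-comm _ _ ⟩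
      ∣ z ∣ ^ k * 1/! k                   ∎

  -- The recurrence fixes each coefficient by the previous one, since the positive factor
  -- `suc k ⋅ 1#` can be cancelled. This identifies a Cauchy product of exponential series without
  -- computing its coefficients.
  exponential-unique : ∀ {z a b} → Exponential z a → Exponential z b → a 0 ≈ b 0 → ∀ k → a k ≈ b k
  exponential-unique a′ b′ a₀≈b₀ zero    = a₀≈b₀
  exponential-unique {z} {a} {b} a′ b′ a₀≈b₀ (suc k) = ≤-antisym
    (*-cancelˡ-≤ (0<fromℕ k) (≤-reflexive eq)) (*-cancelˡ-≤ (0<fromℕ k) (≤-reflexive (sym eq)))
    where
    eq : suc k ⋅ 1# * a (suc k) ≈ suc k ⋅ 1# * b (suc k)
    eq = trans (a′ k) (trans (*-congˡ (exponential-unique a′ b′ a₀≈b₀ k)) (sym (b′ k)))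

  -- The partial sums s of exp c and t of exp 2c satisfy s(N)² ≤ t(2N), so the error
  -- s(N)² − t(N) is at most t(2N) − t(N).
  productError-bound : ∀ c (0≤c : 0# ≤ c) → let open ExponentialSeries c 0≤c in
    ∀ ε → 0# < ε → ∃[ N₀ ] (∀ N → N₀ ℕ.≤ N → productError bound bound N N ≤ ε)
  productError-bound c 0≤c ε 0<ε = proj₁ cauchy , λ N N₀≤N → begin
    series bound N * series bound N - series (conv bound bound) N
      ≤⟨ +-mono-≤ (series-*-series≤ 0≤bound 0≤bound N N) (≤-reflexive refl) ⟩
    series (conv bound bound) (N ℕ.+ N) - series (conv bound bound) N
      ≈⟨ +-cong (C≈ (N ℕ.+ N)) (-‿cong (C≈ N)) ⟩
    partialSum bound₂ (N ℕ.+ N) - partialSum bound₂ N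
      <⟨ +-monoˡ-< (- partialSum bound₂ N) (proj₂ cauchy (N ℕ.+ N) N (ℕ.≤-trans N₀≤N (ℕ.m≤m+n N N)) N₀≤N) ⟩
    (partialSum bound₂ N + ε) - partialSum bound₂ N
      ≈⟨ solve 2 (λ x e → (x :+ e) :- x := e) refl (partialSum bound₂ N) ε ⟩
    ε ∎
    where
    open ExponentialSeries c 0≤c
    open ExponentialSeries (c + c) (≤-+ 0≤c 0≤c) using ()
      renaming (bound to bound₂; 0≤bound to 0≤bound₂; bound-suc to bound₂-suc; module Dominated to Dominated₂)
    -- Both sequences solve f′ = (c + c) f. Their constant terms agree because `bound 0` and
    -- `bound₂ 0` are the same expression, which is equal to 1.
    C≈ : ∀ N → series (conv bound bound) N ≈ partialSum bound₂ N
    C≈ N = trans (series-cong (exponential-unique (conv-exponential bound-suc bound-suc) bound₂-suc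
             (trans (*-cong (trans (*-identityˡ _) 1/!0≈1) refl) (*-identityˡ _))) N)
           (series≈partialSum bound₂ N)
    cauchy = Dominated₂.cauchy bound₂
      (λ k → ≤-reflexive (sym (-‿inverseʳ (bound₂ k))) , ≤-+ (0≤bound₂ k) (0≤bound₂ k)) ε 0<ε

  series-conj : ∀ a N → ℂSeries.series (λ k → conj (a k)) N ≈ᶜ conj (ℂSeries.series a N)
  series-conj a zero    = ℂᵣ.sym (conj-ofReal 0#)
  series-conj a (suc N) = ℂᵣ.trans (ℂᵣ.+-congʳ {conj (a N)} (series-conj a N))
    (refl , solve 2 (λ x y → :- x :+ :- y := :- (x :+ y)) refl (im (ℂSeries.series a N)) (im (a N)))

  conj-exponential : ∀ {z a} → ℂSeries.Exponential z a → ℂSeries.Exponential (conj z) (λ k → conj (a k))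
  conj-exponential {z} {a} a′ k =
    ℂᵣ.trans (ℂᵣ.*-congʳ {conj (a (suc k))} (ℂᵣ.trans (ofReal-⋅1 (suc k))
      (ℂᵣ.trans (ℂᵣ.sym (conj-ofReal (suc k ⋅ 1#))) (conj-cong (ℂᵣ.sym (ofReal-⋅1 (suc k)))))))
    (ℂᵣ.trans (ℂᵣ.sym (conj-* (suc k ⋅ᶜ 1ᶜ) (a (suc k)))) (ℂᵣ.trans (conj-cong (a′ k)) (conj-* z (a k))))

  -- For z = 0 the recurrence kills every coefficient after the constant one. The length is `suc N`
  -- because the empty sum is 0 rather than `a 0`.
  series-exponential-0 : ∀ {z a} → z ≈ᶜ 0ᶜ → ℂSeries.Exponential z a → ∀ N → ℂSeries.series a (suc N) ≈ᶜ a 0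
  series-exponential-0 {z} {a} z≈0 a′ zero    = ℂᵣ.+-identityˡ (a 0)
  series-exponential-0 {z} {a} z≈0 a′ (suc N) = ℂᵣ.trans
    (ℂᵣ.+-cong (series-exponential-0 z≈0 a′ N) (vanish N)) (ℂᵣ.+-identityʳ (a 0))
    where
    -- There is no order on `ℂ` to cancel with, so the factor k + 1 is removed by multiplying with
    -- its real inverse.
    vanish : ∀ k → a (suc k) ≈ᶜ 0ᶜ
    vanish k = ℂR.begin
      a (suc k)                                                 ℂR.≈⟨ ℂᵣ.*-identityˡ (a (suc k)) ⟨
      1ᶜ *ᶜ a (suc k)                                           ℂR.≈⟨ ℂᵣ.*-congʳ {a (suc k)} (ℂᵣ.trans (ofReal-* (1/ suc k) (suc k ⋅ 1#)) (trans (*-comm _ _) (*-1/ (suc k)) , refl)) ⟨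
      (ofReal (1/ suc k) *ᶜ ofReal (suc k ⋅ 1#)) *ᶜ a (suc k)   ℂR.≈⟨ ℂᵣ.*-assoc (ofReal (1/ suc k)) (ofReal (suc k ⋅ 1#)) (a (suc k)) ⟩
      ofReal (1/ suc k) *ᶜ (ofReal (suc k ⋅ 1#) *ᶜ a (suc k))   ℂR.≈⟨ ℂᵣ.*-congˡ {ofReal (1/ suc k)} (ℂᵣ.trans (ℂᵣ.*-congʳ {a (suc k)} (ℂᵣ.sym (ofReal-⋅1 (suc k)))) (a′ k)) ⟩
      ofReal (1/ suc k) *ᶜ (z *ᶜ a k)                           ℂR.≈⟨ ℂᵣ.*-congˡ {ofReal (1/ suc k)} (ℂᵣ.trans (ℂᵣ.*-congʳ {a k} z≈0) (ℂᵣ.zeroˡ (a k))) ⟩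
      ofReal (1/ suc k) *ᶜ 0ᶜ                                   ℂR.≈⟨ ℂᵣ.zeroʳ (ofReal (1/ suc k)) ⟩
      0ᶜ                                                        ℂR.∎

  -- For the partial sum s, the product error of the series of exp(z) and its conjugate is |s|² - 1,
  -- because z + conj z = 0 makes the convolution sum up to 1. Bounding the real part of the negated
  -- error by its modulus gives this side of the estimate.
  ∣exp∣-imaginary : ∀ z → re z ≈ 0# → ∀ ε → 0# < ε →
    ∃[ N₀ ] (∀ N → N₀ ℕ.≤ N → 1# ≤ normSq (ℂSeries.series (expTerm z) N) + ε)
  -- The successor forces N to be positive, so that the sum of the convolution contains its constant
  -- term 1.
  ∣exp∣-imaginary z re≈0 ε 0<ε = suc N₀ , claim
    where
    open ExponentialSeries ∣ z ∣ (0≤∣∣ z)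
    a b : ℕ → ℂ
    a = expTerm z
    b k = conj (a k)
    N₀ = proj₁ (productError-bound ∣ z ∣ (0≤∣∣ z) ε 0<ε)
    a≤ : ∀ k → ∣ a k ∣ ≤ bound k
    a≤ k = ≤-reflexive (∣expTerm∣ z k)
    b≤ : ∀ k → ∣ b k ∣ ≤ bound k
    b≤ k = ≤-respˡ-≈ (sym (∣conj∣ (a k))) (a≤ k)
    z+z̄≈0 : z +ᶜ conj z ≈ᶜ 0ᶜ
    z+z̄≈0 = trans (+-cong re≈0 re≈0) (+-identityˡ 0#) , -‿inverseʳ (im z)
    a₀b₀≈1 : a 0 *ᶜ b 0 ≈ᶜ 1ᶜ
    a₀b₀≈1 = ℂᵣ.trans (ℂᵣ.*-cong {a 0} {1ᶜ} {b 0} {1ᶜ} a₀≈1 (ℂᵣ.trans (conj-cong a₀≈1) (conj-ofReal 1#))) (ℂᵣ.*-identityˡ 1ᶜ)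
      where
      a₀≈1 : a 0 ≈ᶜ 1ᶜ
      a₀≈1 = ℂᵣ.trans (ℂᵣ.*-identityʳ (ofReal (1/! 0))) (1/!0≈1 , refl)
    C≈1 : ∀ N → ℂSeries.series (ℂSeries.conv a b) (suc N) ≈ᶜ 1ᶜ
    C≈1 N = ℂᵣ.trans (series-exponential-0 z+z̄≈0
      (ℂSeries.conv-exponential (expTerm-exponential z) (conj-exponential (expTerm-exponential z))) N) a₀b₀≈1

    claim : ∀ N → suc N₀ ℕ.≤ N → 1# ≤ normSq (ℂSeries.series a N) + ε
    claim N@(suc N′) N₀<N = begin
      1#                                             ≈⟨ solve 2 (λ n o → o := n :+ (o :- n)) refl (normSq s) 1# ⟩
      normSq s + (1# - normSq s)                     ≤⟨ +-mono-≤ (≤-reflexive refl) (begin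
        1# - normSq s                                  ≈⟨ solve 2 (λ n o → o :- n := :- (n :- o)) refl (normSq s) 1# ⟩
        - (normSq s - 1#)                              ≈⟨ -‿cong (proj₁ error≈) ⟨
        - re E                                         ≤⟨ re≤∣∣ (ℂᵣ.- E) ⟩
        ∣ ℂᵣ.- E ∣                                     ≈⟨ ∣-∣ E ⟩
        ∣ E ∣                                          ≤⟨ ∣productError∣ b≤ a≤ {N} {N} ℕ.≤-refl ⟩
        productError bound bound N N                   ≤⟨ proj₂ (productError-bound ∣ z ∣ (0≤∣∣ z) ε 0<ε) N (ℕ.<⇒≤ N₀<N) ⟩
        ε                                              ∎) ⟩
      normSq s + ε                                   ∎
      where
      s = ℂSeries.series a N
      E = ℂSeries.productError a b N N
      error≈ : E ≈ᶜ ofReal (normSq s) ℂᵣ.- 1ᶜ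
      error≈ = ℂᵣ.+-cong (ℂᵣ.trans (ℂᵣ.*-congˡ {s} (series-conj a N)) (*-conj s)) (ℂᵣ.-‿cong (C≈1 N′))

eventually-all : ∀ {n} {P : Fin n → ℕ → Set} →
  (∀ j → ∃[ N₀ ] (∀ N → N₀ ℕ.≤ N → P j N)) → ∃[ N₀ ] (∀ N → N₀ ℕ.≤ N → ∀ j → P j N)
eventually-all {zero}  ev = 0 , λ _ _ ()
eventually-all {suc n} ev with ev zero | eventually-all (λ j → ev (suc j))
... | N₁ , P₁ | N₂ , P₂ = N₁ ℕ.⊔ N₂ , λ where
  N N₀≤N zero    → P₁ N (ℕ.≤-trans (ℕ.m≤m⊔n N₁ N₂) N₀≤N)
  N N₀≤N (suc j) → P₂ N (ℕ.≤-trans (ℕ.m≤n⊔m N₁ N₂) N₀≤N) j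

-- Symmetric matrices and the reality of their eigenvalues.

module Spectrum (R : RealNumbers) where
  open Reals R
  open OrderedField R
  open Complex R
  open Exponentials R
  open RingSolver commutativeRing
  open ≤-Reasoning

  Symmetricʳ : ∀ {n} → Matrixʳ n → Set
  Symmetricʳ M = ∀ i j → M i j ≈ M j i

  matrixOf-symmetric : ∀ kind {n} (X : WeightedGraph n) → Symmetricʳ (matrixOf kind X)
  matrixOf-symmetric kind X = go kind
    where
    open WeightedGraph X
    degreeMatrix-symmetric : Symmetricʳ (degreeMatrix X)
    degreeMatrix-symmetric i j with i ≟ j | j ≟ i
    ... | yes ≡.refl | yes _   = refl
    ... | yes i≡j    | no j≢i  = ⊥-elim (j≢i (≡.sym i≡j))
    ... | no i≢j     | yes j≡i = ⊥-elim (i≢j (≡.sym j≡i))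
    ... | no _       | no _    = refl
    go : ∀ kind → Symmetricʳ (matrixOf kind X)
    go A i j = weight-sym i j
    go L i j = +-cong (degreeMatrix-symmetric i j) (-‿cong (weight-sym i j))
    go Q i j = +-cong (degreeMatrix-symmetric i j) (weight-sym i j)

  module _ {n} {M : Matrixʳ n} (M-sym : Symmetricʳ M) where

    bilinear-symmetric : ∀ (x y : Fin n → Carrier) →
      sum (λ i → x i * sum (λ j → M i j * y j)) ≈ sum (λ i → y i * sum (λ j → M i j * x j))
    bilinear-symmetric x y = begin-equality
      sum (λ i → x i * sum (λ j → M i j * y j))      ≈⟨ ℝΣ.sum-cong-≋ (λ i → ℝΣ.*-distribˡ-sum (x i) (λ j → M i j * y j)) ⟩
      sum (λ i → sum (λ j → x i * (M i j * y j)))    ≈⟨ ℝΣ.∑-comm (λ i j → x i * (M i j * y j)) ⟩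
      sum (λ j → sum (λ i → x i * (M i j * y j)))    ≈⟨ ℝΣ.sum-cong-≋ (λ j → ℝΣ.sum-cong-≋ (λ i → trans
                                                          (solve 3 (λ x m y → x :* (m :* y) := y :* (m :* x)) refl (x i) (M i j) (y j))
                                                          (*-congˡ (*-congʳ (M-sym i j))))) ⟩
      sum (λ j → sum (λ i → y j * (M j i * x i)))    ≈⟨ ℝΣ.sum-cong-≋ (λ j → ℝΣ.*-distribˡ-sum (y j) (λ i → M j i * x i)) ⟨
      sum (λ j → y j * sum (λ i → M j i * x i))      ∎

    -- With v = x + iy, the real and imaginary parts of Mv = μv give x_i (My)_i - y_i (Mx)_i = im μ
    -- |v_i|². Summed over i, the left side vanishes by symmetry, so im μ times Σ |v_i|² is 0.
    -- Nonvanishing of v is only a negation, yet it suffices: by tightness it is enough to refute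
    -- that im μ is apart from 0, and if it were, dividing by it would make v zero.
    eigenvalue-real : ∀ {v μ} → ¬ (∀ j → v j ≈ᶜ 0ᶜ) →
      (∀ i → (complexify M *ᵥ v) i ≈ᶜ μ *ᶜ v i) → im μ ≈ 0#
    eigenvalue-real {v} {μ} v≉0 Mv≈μv = proj₁ (tight b 0#) λ b#0 → v≉0 (v≈0 (begin-equality
        S                   ≈⟨ *-identityˡ S ⟨
        1# * S              ≈⟨ *-congʳ (*-inv b#0) ⟨
        (b * inv b#0) * S   ≈⟨ solve 3 (λ b i s → (b :* i) :* s := i :* (b :* s)) refl b (inv b#0) S ⟩
        inv b#0 * (b * S)   ≈⟨ *-congˡ bS≈0 ⟩
        inv b#0 * 0#        ≈⟨ zeroʳ _ ⟩
        0#                  ∎))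
      where
      b = im μ
      x y Mx My : Fin n → Carrier
      x j = re (v j)
      y j = im (v j)
      Mx i = sum (λ j → M i j * x j)
      My i = sum (λ j → M i j * y j)
      S = sum (λ j → normSq (v j))
      Mx≈ : ∀ i → Mx i ≈ re (μ *ᶜ v i)
      Mx≈ i = trans (sym (ℝΣ.sum-cong-≋ (λ j → proj₁ (ofReal-*ˡ (M i j) (v j))))) (proj₁ (Mv≈μv i))
      My≈ : ∀ i → My i ≈ im (μ *ᶜ v i)
      My≈ i = trans (sym (ℝΣ.sum-cong-≋ (λ j → proj₂ (ofReal-*ˡ (M i j) (v j))))) (proj₂ (Mv≈μv i))
      xMy≈ : ∀ i → x i * My i ≈ y i * Mx i + b * normSq (v i)
      xMy≈ i = begin-equality
        x i * My i                                  ≈⟨ *-congˡ (My≈ i) ⟩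
        x i * im (μ *ᶜ v i)                         ≈⟨ solve 4 (λ a b x y → x :* (a :* y :+ b :* x)
                                                         := y :* (a :* x :- b :* y) :+ b :* (x :* x :+ y :* y)) refl (re μ) b (x i) (y i) ⟩
        y i * re (μ *ᶜ v i) + b * normSq (v i)      ≈⟨ +-congʳ (*-congˡ (Mx≈ i)) ⟨
        y i * Mx i + b * normSq (v i)               ∎
      bS≈0 : b * S ≈ 0#
      bS≈0 = begin-equality
        b * S                                                        ≈⟨ ℝΣ.*-distribˡ-sum b (λ j → normSq (v j)) ⟩
        sum (λ i → b * normSq (v i))                                 ≈⟨ solve 2 (λ s t → t := (s :+ t) :- s) refl _ _ ⟩
        (sum (λ i → y i * Mx i) + sum (λ i → b * normSq (v i))) - sum (λ i → y i * Mx i)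
          ≈⟨ +-congʳ (trans (sym (ℝΣ.∑-distrib-+ (λ i → y i * Mx i) (λ i → b * normSq (v i)))) (sym (ℝΣ.sum-cong-≋ xMy≈))) ⟩
        sum (λ i → x i * My i) - sum (λ i → y i * Mx i)              ≈⟨ +-congʳ (bilinear-symmetric x y) ⟩
        sum (λ i → y i * Mx i) - sum (λ i → y i * Mx i)              ≈⟨ -‿inverseʳ _ ⟩
        0#                                                           ∎
      v≈0 : S ≈ 0# → ∀ j → v j ≈ᶜ 0ᶜ
      v≈0 S≈0 j = x²≈0⇒x≈0 (≤-antisym (≤-trans (≤-by (0≤x² (y j)) refl) normSq≤0) (0≤x² (x j)))
                , x²≈0⇒x≈0 (≤-antisym (≤-trans (≤-by (0≤x² (x j)) (+-comm _ _)) normSq≤0) (0≤x² (y j)))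
        where
        normSq≤0 : normSq (v j) ≤ 0#
        normSq≤0 = ≤-respʳ-≈ S≈0 (x≤sum (λ j → normSq (v j)) (λ j → 0≤normSq (v j)) j)

  -- Left eigenvectors and the matrix exponential.

  module _ {n} (Z : Matrixᶜ n) where
    open MatrixExponential Z

    expPartial : ℕ → Matrixᶜ n
    expPartial N i j = partialSum (reTerm i j) N +i partialSum (imTerm i j) N

    expPartial-suc : ∀ N i j → expPartial (suc N) i j ≈ᶜ expPartial N i j +ᶜ ofReal (1/! N) *ᶜ (Z ^ₘ N) i j
    expPartial-suc N i j = ℂᵣ.+-congˡ {expPartial N i j} (ℂᵣ.sym (ofReal-*ˡ (1/! N) ((Z ^ₘ N) i j)))

    expPartial-converges : ∀ i j ε → 0# < ε →
      ∃[ N₀ ] (∀ N → N₀ ℕ.≤ N → ∣ expPartial N i j ℂᵣ.- expₘ Z i j ∣ ≤ ε + ε)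
    expPartial-converges i j ε 0<ε = proj₁ reLim ℕ.⊔ proj₁ imLim , λ N N₀≤N → ∣∣-components
        (close (proj₂ reLim N (ℕ.≤-trans (ℕ.m≤m⊔n (proj₁ reLim) (proj₁ imLim)) N₀≤N)))
        (close (proj₂ imLim N (ℕ.≤-trans (ℕ.m≤n⊔m (proj₁ reLim) (proj₁ imLim)) N₀≤N)))
      where
      reLim = proj₂ (lim (partialSum (reTerm i j)) (reCauchy i j)) ε 0<ε
      imLim = proj₂ (lim (partialSum (imTerm i j)) (imCauchy i j)) ε 0<ε
      close : ∀ {a l} → a < l + ε × l < a + ε → ∣ a - l ∣≤ ε
      close {a} {l} (p , q) =
          ≤-respʳ-≈ (solve 3 (λ a l e → (l :+ e) :- a := e :- (a :- l)) refl a l ε) (<⇒≤ (<-diff p))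
        , ≤-respʳ-≈ (solve 3 (λ a l e → (a :+ e) :- l := e :+ (a :- l)) refl a l ε) (<⇒≤ (<-diff q))

    module _ {v : Vectorᶜ n} {ζ : ℂ} (vZ≈ζv : ∀ l → sumᶜ (λ j → v j *ᶜ Z j l) ≈ᶜ ζ *ᶜ v l) where

      -- `_^ₘ_` adds each new factor on the left, where the row vector meets it first: v (Z Zᵏ) = (v
      -- Z) Zᵏ = ζ (v Zᵏ).
      leftEigenvector-^ : ∀ k u → sumᶜ (λ j → v j *ᶜ (Z ^ₘ k) j u) ≈ᶜ ζ ^ᶜ k *ᶜ v u
      leftEigenvector-^ zero u = ℂR.begin
        sumᶜ (λ j → v j *ᶜ 𝕖 j u)   ℂR.≈⟨ sumᶜ-cong (λ j → ℂᵣ.*-congˡ {v j} (𝕖-sym j u)) ⟩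
        sumᶜ (λ j → v j *ᶜ 𝕖 u j)   ℂR.≈⟨ sumᶜ-𝕖 v u ⟩
        v u                         ℂR.≈⟨ ℂᵣ.*-identityˡ (v u) ⟨
        1ᶜ *ᶜ v u                   ℂR.∎
        where
        𝕖-sym : ∀ (j u : Fin n) → 𝕖 j u ≈ᶜ 𝕖 u j
        𝕖-sym j u with j ≟ u | u ≟ j
        ... | yes _   | yes _   = ℂᵣ.refl
        ... | yes j≡u | no u≢j  = ⊥-elim (u≢j (≡.sym j≡u))
        ... | no j≢u  | yes u≡j = ⊥-elim (j≢u (≡.sym u≡j))
        ... | no _    | no _    = ℂᵣ.refl
      leftEigenvector-^ (suc k) u = ℂR.begin
        sumᶜ (λ j → v j *ᶜ sumᶜ (λ l → Z j l *ᶜ P l))      ℂR.≈⟨ sumᶜ-cong (λ j → *-distribˡ-sumᶜ (v j) (λ l → Z j l *ᶜ P l)) ⟩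
        sumᶜ (λ j → sumᶜ (λ l → v j *ᶜ (Z j l *ᶜ P l)))    ℂR.≈⟨ sumᶜ-comm (λ j l → v j *ᶜ (Z j l *ᶜ P l)) ⟩
        sumᶜ (λ l → sumᶜ (λ j → v j *ᶜ (Z j l *ᶜ P l)))    ℂR.≈⟨ sumᶜ-cong (λ l → sumᶜ-cong (λ j → ℂᵣ.trans
                                                                   (ℂᵣ.sym (ℂᵣ.*-assoc (v j) (Z j l) (P l))) (ℂᵣ.*-comm (v j *ᶜ Z j l) (P l)))) ⟩
        sumᶜ (λ l → sumᶜ (λ j → P l *ᶜ (v j *ᶜ Z j l)))    ℂR.≈⟨ sumᶜ-cong (λ l → *-distribˡ-sumᶜ (P l) (λ j → v j *ᶜ Z j l)) ⟨
        sumᶜ (λ l → P l *ᶜ sumᶜ (λ j → v j *ᶜ Z j l))      ℂR.≈⟨ sumᶜ-cong (λ l → ℂᵣ.*-congˡ {P l} (vZ≈ζv l)) ⟩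
        sumᶜ (λ l → P l *ᶜ (ζ *ᶜ v l))                     ℂR.≈⟨ sumᶜ-cong (λ l → ℂᵣ.trans (x∙yz≈y∙xz (P l) ζ (v l)) (ℂᵣ.*-congˡ {ζ} (ℂᵣ.*-comm (P l) (v l)))) ⟩
        sumᶜ (λ l → ζ *ᶜ (v l *ᶜ P l))                     ℂR.≈⟨ *-distribˡ-sumᶜ ζ (λ l → v l *ᶜ P l) ⟨
        ζ *ᶜ sumᶜ (λ l → v l *ᶜ P l)                       ℂR.≈⟨ ℂᵣ.*-congˡ {ζ} (leftEigenvector-^ k u) ⟩
        ζ *ᶜ (ζ ^ᶜ k *ᶜ v u)                               ℂR.≈⟨ ℂᵣ.*-assoc ζ (ζ ^ᶜ k) (v u) ⟨
        (ζ *ᶜ ζ ^ᶜ k) *ᶜ v u                               ℂR.∎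
        where
        P : Fin n → ℂ
        P l = (Z ^ₘ k) l u

      leftEigenvector-expPartial : ∀ N u →
        sumᶜ (λ j → v j *ᶜ expPartial N j u) ≈ᶜ ℂSeries.series (expTerm ζ) N *ᶜ v u
      leftEigenvector-expPartial zero u = ℂᵣ.trans (sumᶜ-0 _ (λ j → ℂᵣ.zeroʳ (v j))) (ℂᵣ.sym (ℂᵣ.zeroˡ (v u)))
      leftEigenvector-expPartial (suc N) u = ℂR.begin
        sumᶜ (λ j → v j *ᶜ expPartial (suc N) j u)
          ℂR.≈⟨ sumᶜ-cong (λ j → ℂᵣ.trans (ℂᵣ.*-congˡ {v j} (expPartial-suc N j u))
                  (ℂᵣ.trans (ℂᵣ.distribˡ (v j) (expPartial N j u) (f *ᶜ P j))
                            (ℂᵣ.+-congˡ {v j *ᶜ expPartial N j u} (x∙yz≈y∙xz (v j) f (P j))))) ⟩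
        sumᶜ (λ j → v j *ᶜ expPartial N j u +ᶜ f *ᶜ (v j *ᶜ P j))
          ℂR.≈⟨ sumᶜ-+ (λ j → v j *ᶜ expPartial N j u) (λ j → f *ᶜ (v j *ᶜ P j)) ⟩
        sumᶜ (λ j → v j *ᶜ expPartial N j u) +ᶜ sumᶜ (λ j → f *ᶜ (v j *ᶜ P j))
          ℂR.≈⟨ ℂᵣ.+-cong (leftEigenvector-expPartial N u)
                  (ℂᵣ.trans (ℂᵣ.sym (*-distribˡ-sumᶜ f (λ j → v j *ᶜ P j)))
                  (ℂᵣ.trans (ℂᵣ.*-congˡ {f} (leftEigenvector-^ N u)) (ℂᵣ.sym (ℂᵣ.*-assoc f (ζ ^ᶜ N) (v u))))) ⟩
        e *ᶜ v u +ᶜ expTerm ζ N *ᶜ v u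
          ℂR.≈⟨ ℂᵣ.distribʳ (v u) e (expTerm ζ N) ⟨
        ℂSeries.series (expTerm ζ) (suc N) *ᶜ v u ℂR.∎
        where
        f = ofReal (1/! N)
        e = ℂSeries.series (expTerm ζ) N
        P : Fin n → ℂ
        P j = (Z ^ₘ N) j u

      -- Take N so large that the scalar partial sum e satisfies 1 ≤ |e| + ε and all entries of
      -- column u are within 2ε of their limits. Then e v_u = W + Δ with |Δ| ≤ 2εT. The loss from e
      -- is ε|v_u| and that from Δ is 2εT, whence the constant `∣ v u ∣ + (T + T)`.
      leftEigenvector-expₘ : re ζ ≈ 0# → ∀ u → ∣ v u ∣ ≤ ∣ sumᶜ (λ j → v j *ᶜ expₘ Z j u) ∣
      leftEigenvector-expₘ re≈0 u = ≤-limit (∣ v u ∣ + (T + T)) (≤-+ (0≤∣∣ (v u)) (≤-+ 0≤T 0≤T)) bound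
        where
        T = sum (λ j → ∣ v j ∣)
        0≤T : 0# ≤ T
        0≤T = 0≤sum _ (λ j → 0≤∣∣ (v j))
        E : Fin n → ℂ
        E j = expₘ Z j u
        W = sumᶜ (λ j → v j *ᶜ E j)

        bound : ∀ ε → 0# < ε → ∣ v u ∣ ≤ ∣ W ∣ + (∣ v u ∣ + (T + T)) * ε
        bound ε 0<ε = begin
          ∣ v u ∣                              ≈⟨ *-identityˡ _ ⟨
          1# * ∣ v u ∣                         ≤⟨ *-monoˡ-≤ (0≤∣∣ (v u)) 1≤∣e∣+ε ⟩
          (∣ e ∣ + ε) * ∣ v u ∣                ≈⟨ distribʳ (∣ v u ∣) (∣ e ∣) ε ⟩
          ∣ e ∣ * ∣ v u ∣ + ε * ∣ v u ∣        ≈⟨ +-congʳ (trans (sym (∣∣-* e (v u))) (∣∣-cong (ℂᵣ.trans (ℂᵣ.sym (leftEigenvector-expPartial N u)) split))) ⟩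
          ∣ W +ᶜ Δ ∣ + ε * ∣ v u ∣             ≤⟨ +-mono-≤ (≤-trans (triangle W Δ) (+-mono-≤ (≤-reflexive refl) ∣Δ∣≤)) (≤-reflexive refl) ⟩
          (∣ W ∣ + (ε + ε) * T) + ε * ∣ v u ∣  ≈⟨ solve 4 (λ w e t x → (w :+ (e :+ e) :* t) :+ e :* x := w :+ (x :+ (t :+ t)) :* e) refl (∣ W ∣) ε T (∣ v u ∣) ⟩
          ∣ W ∣ + (∣ v u ∣ + (T + T)) * ε      ∎
          where
          near = eventually-all (λ j → expPartial-converges j u ε 0<ε)
          unit = ∣exp∣-imaginary ζ re≈0 ε 0<ε
          N = proj₁ near ℕ.⊔ proj₁ unit
          e = ℂSeries.series (expTerm ζ) N
          D : Fin n → ℂ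
          D j = expPartial N j u ℂᵣ.- E j
          Δ = sumᶜ (λ j → v j *ᶜ D j)

          -- The bound is known for |e|². If |e| + ε < 1, then |e| < 1, hence |e|² ≤ |e| and |e|² +
          -- ε < 1, which that bound excludes.
          1≤∣e∣+ε : 1# ≤ ∣ e ∣ + ε
          1≤∣e∣+ε ∣e∣+ε<1 = proj₂ unit N (ℕ.m≤n⊔m (proj₁ near) (proj₁ unit)) (begin-strict
            normSq e + ε       ≈⟨ +-congʳ (∣∣-square e) ⟨
            ∣ e ∣ * ∣ e ∣ + ε  ≤⟨ +-mono-≤ (*-monoʳ-≤ (0≤∣∣ e) (<⇒≤ (<-trans (<-by 0<ε refl) ∣e∣+ε<1))) (≤-reflexive refl) ⟩
            ∣ e ∣ * 1# + ε     ≈⟨ +-congʳ (*-identityʳ _) ⟩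
            ∣ e ∣ + ε          <⟨ ∣e∣+ε<1 ⟩
            1#                 ∎)

          split : sumᶜ (λ j → v j *ᶜ expPartial N j u) ≈ᶜ W +ᶜ Δ
          split = ℂᵣ.trans (sumᶜ-cong (λ j → ℂᵣ.trans
              (ℂᵣ.*-congˡ {v j} (solve 2 (λ x y → x := y :+ (x :- y)) refl _ _ , solve 2 (λ x y → x := y :+ (x :- y)) refl _ _))
              (ℂᵣ.distribˡ (v j) (E j) (D j))))
            (sumᶜ-+ (λ j → v j *ᶜ E j) (λ j → v j *ᶜ D j))

          ∣Δ∣≤ : ∣ Δ ∣ ≤ (ε + ε) * T
          ∣Δ∣≤ = begin
            ∣ Δ ∣                            ≤⟨ ∣∣-sum (λ j → v j *ᶜ D j) ⟩
            sum (λ j → ∣ v j *ᶜ D j ∣)       ≤⟨ sum-mono-≤ _ _ (λ j → ≤-respˡ-≈ (trans (*-comm _ _) (sym (∣∣-* (v j) (D j))))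
                                                  (*-monoˡ-≤ (0≤∣∣ (v j)) (proj₂ near N (ℕ.m≤m⊔n (proj₁ near) (proj₁ unit)) j))) ⟩
            sum (λ j → (ε + ε) * ∣ v j ∣)    ≈⟨ ℝΣ.*-distribˡ-sum (ε + ε) (λ j → ∣ v j ∣) ⟨
            (ε + ε) * T                      ∎

  -- Uniform mixing and the eigenvector inequality.

  module _ {n} .{{_ : NonZero n}} (M : Matrixʳ n) where

    deviation≈ : ∀ t u j → deviation M t u j ≈ᶜ ofReal (normSq (U M t j u) - 1/ n)
    deviation≈ t u j = +-congʳ (proj₁ product)
                     , trans (+-congʳ (proj₂ product)) (-‿inverseʳ 0#)
      where
      product : (U M t *ᵥ 𝕖 u) j *ᶜ (conjₘ (U M t) *ᵥ 𝕖 u) j ≈ᶜ ofReal (normSq (U M t j u))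
      product = ℂᵣ.trans (ℂᵣ.*-cong (sumᶜ-𝕖 (U M t j) u) (sumᶜ-𝕖 (conjₘ (U M t) j) u)) (*-conj (U M t j u))

    normSq-U≤ : ∀ {t u ε} → ‖ deviation M t u ‖ < ε → ∀ j → normSq (U M t j u) ≤ 1/ n + ε
    normSq-U≤ {t} {u} {ε} dev<ε j = begin
      normSq (U M t j u)                    ≈⟨ solve 2 (λ x y → x := y :+ (x :- y)) refl _ (1/ n) ⟩
      1/ n + (normSq (U M t j u) - 1/ n)    ≈⟨ +-congˡ (proj₁ (deviation≈ t u j)) ⟨
      1/ n + re (deviation M t u j)         ≤⟨ +-mono-≤ (≤-reflexive refl) (begin
        re (deviation M t u j)                ≤⟨ re≤∣∣ (deviation M t u j) ⟩
        ∣ deviation M t u j ∣                 ≤⟨ √-mono-≤ (0≤normSq _) (x≤sum _ (λ j → 0≤normSq (deviation M t u j)) j) ⟩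
        ‖ deviation M t u ‖                   <⟨ dev<ε ⟩
        ε                                     ∎) ⟩
      1/ n + ε                              ∎

    module _ (M-sym : Symmetricʳ M) where

      -- Symmetry makes v a row eigenvector too, so the sum runs over column u of U(t), the column
      -- that mixing at u controls.
      eigenvector-U : ∀ t u {v} → Eigenvector M v → ∣ v u ∣ ≤ ∣ sumᶜ (λ j → v j *ᶜ U M t j u) ∣
      eigenvector-U t u {v} (v≉0 , μ , Mv≈μv) = leftEigenvector-expₘ _ vZ≈ζv ζ-imaginary u
        where
        s = 𝕚 *ᶜ ofReal t
        vZ≈ζv : ∀ l → sumᶜ (λ j → v j *ᶜ (s *ᶜ ofReal (M j l))) ≈ᶜ (s *ᶜ μ) *ᶜ v l
        vZ≈ζv l = ℂR.begin
          sumᶜ (λ j → v j *ᶜ (s *ᶜ ofReal (M j l)))   ℂR.≈⟨ sumᶜ-cong (λ j → ℂᵣ.trans (x∙yz≈y∙xz (v j) s (ofReal (M j l)))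
                                                              (ℂᵣ.*-congˡ {s} (ℂᵣ.trans (ℂᵣ.*-comm (v j) (ofReal (M j l)))
                                                                (ℂᵣ.*-congʳ {v j} (M-sym j l , refl))))) ⟩
          sumᶜ (λ j → s *ᶜ (ofReal (M l j) *ᶜ v j))   ℂR.≈⟨ *-distribˡ-sumᶜ s (λ j → ofReal (M l j) *ᶜ v j) ⟨
          s *ᶜ sumᶜ (λ j → ofReal (M l j) *ᶜ v j)     ℂR.≈⟨ ℂᵣ.*-congˡ {s} (Mv≈μv l) ⟩
          s *ᶜ (μ *ᶜ v l)                             ℂR.≈⟨ ℂᵣ.*-assoc s μ (v l) ⟨
          (s *ᶜ μ) *ᶜ v l                             ℂR.∎
        ζ-imaginary : re (s *ᶜ μ) ≈ 0#
        ζ-imaginary = trans (+-congˡ (-‿cong (*-congˡ (eigenvalue-real M-sym v≉0 Mv≈μv))))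
          (solve 2 (λ t a → let 𝟘 = con (0 , 0); 𝟙 = con (1 , 0) in
            (𝟘 :* t :- 𝟙 :* 𝟘) :* a :- (𝟘 :* 𝟘 :+ 𝟙 :* t) :* 𝟘 := 𝟘) refl t (re μ))

      -- The inequality is squared before `ε` is removed: √(1/n + ε) would require continuity of the
      -- root, while (1/n + ε)T² is linear in `ε` and fits `≤-limit` with K = T².
      local-mixing-bound : ∀ u → LocalεUniformMixing M u → ∀ v → Eigenvector M v →
        √ (n ⋅ 1#) * ∣ v u ∣ ≤ sum (λ j → ∣ v j ∣)
      local-mixing-bound u mixing v v-eigen = square-cancel-≤ 0≤T (begin
          (√ (n ⋅ 1#) * ∣ v u ∣) * (√ (n ⋅ 1#) * ∣ v u ∣)  ≈⟨ solve 2 (λ r x → (r :* x) :* (r :* x) := (r :* r) :* (x :* x)) refl (√ (n ⋅ 1#)) ∣ v u ∣ ⟩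
          (√ (n ⋅ 1#) * √ (n ⋅ 1#)) * (∣ v u ∣ * ∣ v u ∣)  ≈⟨ *-congʳ (√-square (0≤fromℕ n)) ⟩
          n ⋅ 1# * (∣ v u ∣ * ∣ v u ∣)                     ≤⟨ *-monoʳ-≤ (0≤fromℕ n) (≤-limit (T * T) (0≤x² T) bound) ⟩
          n ⋅ 1# * (1/ n * (T * T))                        ≈⟨ *-assoc _ _ _ ⟨
          (n ⋅ 1# * 1/ n) * (T * T)                        ≈⟨ *-congʳ (*-1/ n) ⟩
          1# * (T * T)                                     ≈⟨ *-identityˡ _ ⟩
          T * T                                            ∎)
        where
        T = sum (λ j → ∣ v j ∣)
        0≤T : 0# ≤ T
        0≤T = 0≤sum _ (λ j → 0≤∣∣ (v j))

        bound : ∀ ε → 0# < ε → ∣ v u ∣ * ∣ v u ∣ ≤ 1/ n * (T * T) + (T * T) * ε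
        bound ε 0<ε = begin
          ∣ v u ∣ * ∣ v u ∣            ≤⟨ *-mono-≤ (0≤∣∣ (v u)) (*-nonneg (0≤√ _) 0≤T) ∣v∣≤ ∣v∣≤ ⟩
          (ρ * T) * (ρ * T)            ≈⟨ solve 2 (λ r t → (r :* t) :* (r :* t) := (r :* r) :* (t :* t)) refl ρ T ⟩
          (ρ * ρ) * (T * T)            ≈⟨ *-congʳ (√-square (≤-+ (<⇒≤ (0<1/ n)) (<⇒≤ 0<ε))) ⟩
          (1/ n + ε) * (T * T)         ≈⟨ solve 3 (λ r e t → (r :+ e) :* t := r :* t :+ t :* e) refl (1/ n) ε (T * T) ⟩
          1/ n * (T * T) + (T * T) * ε ∎
          where
          ρ = √ (1/ n + ε)
          τ = proj₁ (mixing ε 0<ε)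
          ∣v∣≤ : ∣ v u ∣ ≤ ρ * T
          ∣v∣≤ = begin
            ∣ v u ∣                              ≤⟨ eigenvector-U τ u v-eigen ⟩
            ∣ sumᶜ (λ j → v j *ᶜ U M τ j u) ∣    ≤⟨ ∣∣-sum (λ j → v j *ᶜ U M τ j u) ⟩
            sum (λ j → ∣ v j *ᶜ U M τ j u ∣)     ≤⟨ sum-mono-≤ _ _ (λ j → ≤-respˡ-≈ (trans (*-comm _ _) (sym (∣∣-* (v j) (U M τ j u))))
                                                      (*-monoˡ-≤ (0≤∣∣ (v j)) (√-mono-≤ (0≤normSq _) (normSq-U≤ (proj₂ (mixing ε 0<ε)) j)))) ⟩
            sum (λ j → ρ * ∣ v j ∣)              ≈⟨ ℝΣ.*-distribˡ-sum ρ (λ j → ∣ v j ∣) ⟨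
            ρ * T                                ∎

theorem2 : (R : RealNumbers) → let open Reals R in
    (n : ℕ) .{{_ : NonZero n}} (X : WeightedGraph n) (kind : MatrixKind) →
    let M = matrixOf kind X in
    ((u : Fin n) → LocalεUniformMixing M u →
    (v : Vectorᶜ n) → Eigenvector M v → √ (n ⋅ 1#) * ∣ v u ∣ ≤ sum (λ j → ∣ v j ∣))
    × (εUniformMixing M →
    (u : Fin n) (v : Vectorᶜ n) → Eigenvector M v → √ (n ⋅ 1#) * ∣ v u ∣ ≤ sum (λ j → ∣ v j ∣))
theorem2 R n X kind = local , λ mixing u → local u λ ε 0<ε → let (τ , small) = mixing ε 0<ε in τ , small u
  where
  open Spectrum R
  local = local-mixing-bound (Reals.matrixOf R kind X) (matrixOf-symmetric kind X)
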